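{- Let $T\in\mathbb{R}^{n\times n\times n}$ be a real tensor of size $n$. For any integer $r$, $\operatorname{rank}(T)\le r$ if and only if there is a real tensor $S$ of order 3 and size $N=r+n$ such that: (i) If $(S_1,\ldots,S_N)$ denotes the tuple of $x$-slices of $S$, or its tuple of $y$-slices, or its tuple of $z$-slices, then the matrices $S_kS_l^T$ and $S_k^TS_l$ are symmetric for all $k,l\in\{1,\ldots,N\}$. (ii) $T$ is a subtensor of $S$ in the sense that $T_{ijk}=S_{ijk}$ for all $1\le i,j,k\le n$. (iii) Any matrix in the subspace spanned by the $z$-slices of $S$ is of rank at most $r$.
   Context: A tensor of (order 3 and) size $n$ over $K$ is an array $T=(T_{ijk})\in K^{n\times n\times n}$. Its $i$-th $x$-slice is the $n\times n$ matrix $(T_{ijk})_{j,k}$, its $j$-th $y$-slice is $(T_{ijk})_{i,k}$, and its $k$-th $z$-slice is $(T_{ijk})_{i,j}$. For $u,v,w\in K^n$, the tensor $u\otimes v\otimes w$ has entries $u_iv_jw_k$; it has rank one if $u,v,w\ne 0$. The rank over $K$ (here $K=\mathbb{R}$), $\operatorname{rank}(T)$, is the smallest $r$ such that $T$ is a sum of $r$ rank-one tensors over $K$ (with $\operatorname{rank}(0)=0$). The span of slices is taken over $\mathbb{R}$. -}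

module Defs where

open import Algebra.Bundles using (CommutativeRing)
open import Data.Fin.Base using (Fin; inject≤)
open import Data.Integer.Base as ℤ using (ℤ; +_)
open import Data.Nat.Base as ℕ using (ℕ)
open import Data.Product.Base using (_×_; ∃-syntax; Σ-syntax)
open import Data.Vec.Functional using (Vector)
open import Level using (Level; _⊔_; suc)
open import Relation.Binary.Core using (Rel)
open import Relation.Binary.Structures using (IsTotalOrder)
open import Relation.Nullary.Negation.Core using (¬_)

-- The second-order axioms of the real numbers.  They determine the field of
-- reals up to unique isomorphism, so a theorem about ℝ is stated for an
-- arbitrary model.

record CompleteOrderedField (c ℓ₁ ℓ₂ : Level) : Set (suc (c ⊔ ℓ₁ ⊔ ℓ₂)) where
  infix 4 _≤_
  field
    commutativeRing : CommutativeRing c ℓ₁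

  open CommutativeRing commutativeRing public

  field
    _≤_           : Rel Carrier ℓ₂
    isTotalOrder  : IsTotalOrder _≈_ _≤_
    0≉1           : ¬ 0# ≈ 1#
    invertible    : ∀ x → ¬ x ≈ 0# → ∃[ y ] x * y ≈ 1#
    +-monoˡ-≤     : ∀ z {x y} → x ≤ y → x + z ≤ y + z
    *-nonNegative : ∀ {x y} → 0# ≤ x → 0# ≤ y → 0# ≤ x * y

  UpperBound : (Carrier → Set (c ⊔ ℓ₁ ⊔ ℓ₂)) → Carrier → Set (c ⊔ ℓ₁ ⊔ ℓ₂)
  UpperBound P b = ∀ x → P x → x ≤ b

  field
    complete : ∀ (P : Carrier → Set (c ⊔ ℓ₁ ⊔ ℓ₂)) →
               (∃[ x ] P x) → (∃[ b ] UpperBound P b) →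
               ∃[ s ] UpperBound P s × (∀ b → UpperBound P b → s ≤ b)

module RealTensors {c ℓ₁ ℓ₂ : Level} (ℝ : CompleteOrderedField c ℓ₁ ℓ₂) where

  open CompleteOrderedField ℝ
  open import Algebra.Properties.CommutativeMonoid.Sum +-commutativeMonoid
    using (sum; sum-syntax)

  infixl 7 _·_
  infix  8 _ᵀ

  Vec : ℕ → Set c
  Vec n = Vector Carrier n

  Matrix : ℕ → Set c
  Matrix n = Fin n → Fin n → Carrier

  Tensor : ℕ → Set c
  Tensor n = Fin n → Fin n → Fin n → Carrier

  NonZeroVec : ∀ {n} → Vec n → Set ℓ₁
  NonZeroVec u = ¬ (∀ i → u i ≈ 0#)

  _ᵀ : ∀ {n} → Matrix n → Matrix n
  (A ᵀ) i j = A j i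

  _·_ : ∀ {n} → Matrix n → Matrix n → Matrix n
  _·_ {n} A B i j = ∑[ k < n ] (A i k * B k j)

  Symmetric : ∀ {n} → Matrix n → Set ℓ₁
  Symmetric A = ∀ i j → A i j ≈ A j i

  LinearlyIndependent : ∀ {s n} → (Fin s → Vec n) → Set (c ⊔ ℓ₁)
  LinearlyIndependent {s} v =
    ∀ (a : Vec s) → (∀ i → ∑[ p < s ] (a p * v p i) ≈ 0#) → ∀ p → a p ≈ 0#

  column : ∀ {n} → Matrix n → Fin n → Vec n
  column A j i = A i j

  -- No injectivity of f is required: repeated columns are linearly dependent.

  HasIndependentColumns : ∀ {n} → Matrix n → ℕ → Set (c ⊔ ℓ₁)
  HasIndependentColumns {n} A s =
    Σ[ f ∈ (Fin s → Fin n) ] LinearlyIndependent (λ p → column A (f p))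

  IsMatrixRank : ∀ {n} → Matrix n → ℕ → Set (c ⊔ ℓ₁)
  IsMatrixRank A s =
    HasIndependentColumns A s × (∀ t → HasIndependentColumns A t → t ℕ.≤ s)

  _⊗_⊗_ : ∀ {n} → Vec n → Vec n → Vec n → Tensor n
  (u ⊗ v ⊗ w) i j k = u i * v j * w k

  IsRankOne : ∀ {n} → Tensor n → Set (c ⊔ ℓ₁)
  IsRankOne {n} T =
    ∃[ u ] ∃[ v ] ∃[ w ]
      NonZeroVec u × NonZeroVec v × NonZeroVec w ×
      (∀ (i j k : Fin n) → T i j k ≈ (u ⊗ v ⊗ w) i j k)

  IsSumOfRankOnes : ∀ {n} → Tensor n → ℕ → Set (c ⊔ ℓ₁)
  IsSumOfRankOnes {n} T s =
    Σ[ X ∈ (Fin s → Tensor n) ]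
      (∀ p → IsRankOne (X p)) ×
      (∀ i j k → T i j k ≈ ∑[ p < s ] X p i j k)

  IsTensorRank : ∀ {n} → Tensor n → ℕ → Set (c ⊔ ℓ₁)
  IsTensorRank T s =
    IsSumOfRankOnes T s × (∀ t → IsSumOfRankOnes T t → s ℕ.≤ t)

  -- Ranks are given by their graphs, so "the rank is at most r" reads
  -- "the rank is some s, and s ≤ r".

  TensorRank≤ : ∀ {n} → Tensor n → ℤ → Set (c ⊔ ℓ₁)
  TensorRank≤ T r = ∃[ s ] IsTensorRank T s × + s ℤ.≤ r

  MatrixRank≤ : ∀ {n} → Matrix n → ℤ → Set (c ⊔ ℓ₁)
  MatrixRank≤ A r = ∃[ s ] IsMatrixRank A s × + s ℤ.≤ r

  xSlice ySlice zSlice : ∀ {n} → Tensor n → Fin n → Matrix n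
  xSlice T i = λ j k → T i j k
  ySlice T j = λ i k → T i j k
  zSlice T k = λ i j → T i j k

  SymmetricProducts : ∀ {n} → (Fin n → Matrix n) → Set ℓ₁
  SymmetricProducts S =
    ∀ k l → Symmetric (S k · (S l) ᵀ) × Symmetric ((S k) ᵀ · S l)

  IsSubtensor : ∀ {n N} → Tensor n → Tensor N → Set ℓ₁
  IsSubtensor {n} {N} T S =
    Σ[ n≤N ∈ n ℕ.≤ N ]
      (∀ i j k → T i j k ≈ S (inject≤ i n≤N) (inject≤ j n≤N) (inject≤ k n≤N))

  InSpan : ∀ {N m} → Matrix N → (Fin m → Matrix N) → Set (c ⊔ ℓ₁)
  InSpan {N} {m} M Z =
    Σ[ a ∈ Vec m ] (∀ i j → M i j ≈ ∑[ k < m ] (a k * Z k i j))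

{-# OPTIONS --safe #-}
-- If T = Σ_p u_p ⊗ v_p ⊗ w_p with r terms, append r coordinates to the u_p, to the v_p and to the w_p
-- so that each family becomes pairwise orthogonal; S is the sum of the extended terms.
--
-- Conversely, condition (i) makes the matrices S_k S_lᵀ of the z-slices symmetric and commuting, so they
-- have a common eigenvector u outside the joint kernel of the contractions x ↦ S(x, ·, ·).  The conditions
-- then force S(u, ·, ·) to be a multiple of some v ⊗ w, and S = σ u ⊗ v ⊗ w + S′ where S′ is annihilated by
-- u, v and w.  The remainder S′ satisfies (i) again, and the ranks in the span of its z-slices are bounded
-- by r − 1, so that r steps decompose S and hence its subtensor T.
--
-- A real symmetric A has an eigenvector in every nonzero invariant subspace without any appeal to compactness:
-- for s the supremum of the Rayleigh quotients, s - A is positive semidefinite, and were it injective it would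
-- be invertible by a polynomial in itself, hence bounded below by some t > 0, so that s - t were an upper bound.

module Submission where

open import Defs
open import Algebra.Bundles using (CommutativeRing)
open import Algebra.Solver.Ring.AlmostCommutativeRing using (fromCommutativeRing; _-Raw-AlmostCommutative⟶_)
open import Axiom.ExcludedMiddle using (ExcludedMiddle)
open import Data.Empty using (⊥-elim)
open import Data.Fin.Base using (Fin; zero; suc; toℕ; punchIn; punchOut; remQuot; combine; inject≤)
open import Data.Fin.Properties using (_≟_; punchIn-punchOut; remQuot-combine)
open import Data.Integer.Base as ℤ using (ℤ; +_; -[1+_]; _⊖_)
import Data.Integer.Properties as ℤ
open import Data.Maybe.Base using (Maybe; just; nothing)
open import Data.Nat.Base as ℕ using (ℕ; zero; suc)
import Data.Nat.Properties as ℕ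
open import Data.Product.Base using (_×_; _,_; proj₁; proj₂; ∃-syntax; Σ-syntax)
open import Data.Sum.Base using (_⊎_; inj₁; inj₂)
open import Data.Vec.Functional using (_∷_)
open import Function.Base using (_∘_; case_of_)
open import Function.Bundles using (_⇔_; mk⇔)
open import Level as Level using (_⊔_; Lift; lift; lower)
open import Relation.Binary.PropositionalEquality.Core as ≡ using (_≡_)
open import Relation.Binary.Structures using (IsTotalOrder)
open import Relation.Nullary.Decidable using (Dec; yes; no; map′)
open import Relation.Nullary.Negation using (¬_; contradiction)

-- Ring identities with integer coefficients

module IntegerCoefficientSolver {c ℓ} (R : CommutativeRing c ℓ) where

  open CommutativeRing R hiding (zero)
  open import Algebra.Properties.Ring ring
  open import Algebra.Properties.Semiring.Mult.TCOptimised semiring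
    using (×-homo-+; ×1-homo-*; 1+×) renaming (_×_ to _⨉_)
  open import Relation.Binary.Reasoning.Setoid setoid

  -- The canonical homomorphism; as `1 ⨉ x` reduces to `x`, the solver constant `con (+ 1)` reads as
  -- `1#` itself.
  fromℤ : ℤ → Carrier
  fromℤ (+ n)    = n ⨉ 1#
  fromℤ -[1+ n ] = - (suc n ⨉ 1#)

  fromℤ-neg-pos : ∀ n → fromℤ (ℤ.- (+ n)) ≈ - (n ⨉ 1#)
  fromℤ-neg-pos zero    = sym -0#≈0#
  fromℤ-neg-pos (suc n) = refl

  fromℤ-⊖ : ∀ m n → fromℤ (m ⊖ n) ≈ m ⨉ 1# - n ⨉ 1#
  fromℤ-⊖ m zero = sym (trans (+-congˡ -0#≈0#) (+-identityʳ _))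
  fromℤ-⊖ zero (suc n) = sym (+-identityˡ _)
  fromℤ-⊖ (suc m) (suc n) = begin
    fromℤ (suc m ⊖ suc n)                 ≡⟨ ≡.cong fromℤ (ℤ.[1+m]⊖[1+n]≡m⊖n m n) ⟩
    fromℤ (m ⊖ n)                         ≈⟨ fromℤ-⊖ m n ⟩
    m ⨉ 1# - n ⨉ 1#                       ≈⟨ +-congʳ (+-identityˡ _) ⟨
    0# + m ⨉ 1# - n ⨉ 1#                  ≈⟨ +-congʳ (+-congʳ (-‿inverseʳ 1#)) ⟨
    1# - 1# + m ⨉ 1# - n ⨉ 1#             ≈⟨ +-congʳ (trans (+-assoc _ _ _) (trans (+-congˡ (+-comm _ _)) (sym (+-assoc _ _ _)))) ⟩
    1# + m ⨉ 1# - 1# - n ⨉ 1#             ≈⟨ +-assoc _ _ _ ⟩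
    1# + m ⨉ 1# + (- 1# - n ⨉ 1#)         ≈⟨ +-congˡ (-‿+-comm _ _) ⟩
    1# + m ⨉ 1# - (1# + n ⨉ 1#)           ≈⟨ +-cong (1+× m 1#) (-‿cong (1+× n 1#)) ⟨
    suc m ⨉ 1# - suc n ⨉ 1#               ∎

  fromℤ-+ : ∀ i j → fromℤ (i ℤ.+ j) ≈ fromℤ i + fromℤ j
  fromℤ-+ (+ m) (+ n) = ×-homo-+ 1# m n
  fromℤ-+ (+ m) -[1+ n ] = fromℤ-⊖ m (suc n)
  fromℤ-+ -[1+ m ] (+ n) = trans (fromℤ-⊖ n (suc m)) (+-comm _ _)
  fromℤ-+ -[1+ m ] -[1+ n ] = begin
    - (suc (suc (m ℕ.+ n)) ⨉ 1#)     ≡⟨ ≡.cong (λ k → - (suc k ⨉ 1#)) (ℕ.+-suc m n) ⟨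
    - ((suc m ℕ.+ suc n) ⨉ 1#)       ≈⟨ -‿cong (×-homo-+ 1# (suc m) (suc n)) ⟩
    - (suc m ⨉ 1# + suc n ⨉ 1#)      ≈⟨ -‿+-comm _ _ ⟨
    - (suc m ⨉ 1#) - suc n ⨉ 1#      ∎

  fromℤ-neg : ∀ i → fromℤ (ℤ.- i) ≈ - fromℤ i
  fromℤ-neg (+ n)    = fromℤ-neg-pos n
  fromℤ-neg -[1+ n ] = sym (-‿involutive _)

  fromℤ-pos* : ∀ m j → fromℤ (+ m ℤ.* j) ≈ m ⨉ 1# * fromℤ j
  fromℤ-pos* m (+ n) = trans (reflexive (≡.cong fromℤ (≡.sym (ℤ.pos-* m n)))) (×1-homo-* m n)
  fromℤ-pos* m -[1+ n ] = begin
    fromℤ (+ m ℤ.* ℤ.- (+ suc n))    ≡⟨ ≡.cong fromℤ (ℤ.neg-distribʳ-* (+ m) (+ suc n)) ⟨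
    fromℤ (ℤ.- (+ m ℤ.* + suc n))    ≈⟨ fromℤ-neg (+ m ℤ.* + suc n) ⟩
    - fromℤ (+ m ℤ.* + suc n)        ≈⟨ -‿cong (fromℤ-pos* m (+ suc n)) ⟩
    - (m ⨉ 1# * suc n ⨉ 1#)          ≈⟨ -‿distribʳ-* _ _ ⟩
    m ⨉ 1# * - (suc n ⨉ 1#)          ∎

  fromℤ-* : ∀ i j → fromℤ (i ℤ.* j) ≈ fromℤ i * fromℤ j
  fromℤ-* (+ m)    j = fromℤ-pos* m j
  fromℤ-* -[1+ m ] j = begin
    fromℤ (ℤ.- (+ suc m) ℤ.* j)      ≡⟨ ≡.cong fromℤ (ℤ.neg-distribˡ-* (+ suc m) j) ⟨
    fromℤ (ℤ.- (+ suc m ℤ.* j))      ≈⟨ fromℤ-neg (+ suc m ℤ.* j) ⟩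
    - fromℤ (+ suc m ℤ.* j)          ≈⟨ -‿cong (fromℤ-pos* (suc m) j) ⟩
    - (suc m ⨉ 1# * fromℤ j)         ≈⟨ -‿distribˡ-* _ _ ⟩
    - (suc m ⨉ 1#) * fromℤ j         ∎

  fromℤ-morphism : ℤ.+-*-rawRing -Raw-AlmostCommutative⟶ fromCommutativeRing R
  fromℤ-morphism = record
    { ⟦_⟧ = fromℤ ; +-homo = fromℤ-+ ; *-homo = fromℤ-* ; -‿homo = fromℤ-neg ; 0-homo = refl ; 1-homo = refl }

  fromℤ-≟ : ∀ i j → Maybe (fromℤ i ≈ fromℤ j)
  fromℤ-≟ i j with i ℤ.≟ j
  ... | yes i≡j = just (reflexive (≡.cong fromℤ i≡j))
  ... | no  _   = nothing

  open import Algebra.Solver.Ring ℤ.+-*-rawRing (fromCommutativeRing R) fromℤ-morphism fromℤ-≟ public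
    using (solve; _:=_; _:+_; _:*_; _:-_; :-_; con)

module CompleteOrderedFieldTensors {c ℓ₁ ℓ₂} (em : ExcludedMiddle (c ⊔ ℓ₁ ⊔ ℓ₂)) (ℝ : CompleteOrderedField c ℓ₁ ℓ₂) where

  open CompleteOrderedField ℝ hiding (zero)
  open RealTensors ℝ
  open IsTotalOrder isTotalOrder
    using (total; antisym; ≤-respˡ-≈; ≤-respʳ-≈) renaming (refl to ≤-refl; trans to ≤-trans; reflexive to ≤-reflexive)
  open IntegerCoefficientSolver commutativeRing
  open import Algebra.Properties.Ring ring
  import Algebra.Properties.Semiring.Sum semiring as Sum
  open import Algebra.Properties.CommutativeSemigroup *-commutativeSemigroup using (x∙yz≈y∙xz)
  open import Relation.Binary.Reasoning.Setoid setoid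

  -- Ordered fields, finite sums and inner products

  decide : (P : Set (c ⊔ ℓ₁)) → Dec P
  decide P = map′ lower lift (em {Lift ℓ₂ P})

  ≈0? : ∀ x → Dec (x ≈ 0#)
  ≈0? x = map′ lower lift (em {Lift (c ⊔ ℓ₂) (x ≈ 0#)})

  x*y≈0⇒y≈0 : ∀ {x y} → ¬ x ≈ 0# → x * y ≈ 0# → y ≈ 0#
  x*y≈0⇒y≈0 {x} {y} x≉0 xy≈0 with invertible x x≉0
  ... | z , xz≈1 = begin
    y            ≈⟨ *-identityˡ y ⟨
    1# * y       ≈⟨ *-congʳ xz≈1 ⟨
    x * z * y    ≈⟨ solve 3 (λ x y z → x :* z :* y := z :* (x :* y)) refl x y z ⟩
    z * (x * y)  ≈⟨ *-congˡ xy≈0 ⟩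
    z * 0#       ≈⟨ zeroʳ z ⟩
    0#           ∎

  x-y≈0⇒x≈y : ∀ {x y} → x - y ≈ 0# → x ≈ y
  x-y≈0⇒x≈y = x∙y⁻¹≈ε⇒x≈y _ _

  ≤⇒0≤- : ∀ {x y} → x ≤ y → 0# ≤ y - x
  ≤⇒0≤- {x} {y} x≤y = ≤-respˡ-≈ (-‿inverseʳ x) (+-monoˡ-≤ (- x) x≤y)

  0≤-⇒≤ : ∀ {x y} → 0# ≤ y - x → x ≤ y
  0≤-⇒≤ {x} {y} h = ≤-respˡ-≈ (+-identityˡ x) (≤-respʳ-≈ (solve 2 (λ x y → y :- x :+ x := y) refl x y) (+-monoˡ-≤ x h))

  +-mono-≤ : ∀ {w x y z} → w ≤ x → y ≤ z → w + y ≤ x + z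
  +-mono-≤ {w} {x} {y} {z} w≤x y≤z = ≤-trans (+-monoˡ-≤ y w≤x)
    (≤-respˡ-≈ (+-comm y x) (≤-respʳ-≈ (+-comm z x) (+-monoˡ-≤ x y≤z)))

  +-nonNegative : ∀ {x y} → 0# ≤ x → 0# ≤ y → 0# ≤ x + y
  +-nonNegative 0≤x 0≤y = ≤-respˡ-≈ (+-identityˡ 0#) (+-mono-≤ 0≤x 0≤y)

  *-monoʳ-≤ : ∀ {x y z} → 0# ≤ z → x ≤ y → x * z ≤ y * z
  *-monoʳ-≤ {x} {y} {z} 0≤z x≤y = 0≤-⇒≤ (≤-respʳ-≈ ([y-z]x≈yx-zx z y x) (*-nonNegative (≤⇒0≤- x≤y) 0≤z))

  -- By totality only the case `y ≤ x` needs an argument: multiplied by `z` it turns the hypothesis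
  -- into an equality, from which `z` cancels.
  *-cancelʳ-≤ : ∀ {x y z} → 0# ≤ z → ¬ z ≈ 0# → x * z ≤ y * z → x ≤ y
  *-cancelʳ-≤ {x} {y} {z} 0≤z z≉0 xz≤yz with total x y
  ... | inj₁ x≤y = x≤y
  ... | inj₂ y≤x = ≤-reflexive (x-y≈0⇒x≈y (x*y≈0⇒y≈0 z≉0 (begin
    z * (x - y)    ≈⟨ solve 3 (λ x y z → z :* (x :- y) := x :* z :- y :* z) refl x y z ⟩
    x * z - y * z  ≈⟨ +-congʳ (antisym xz≤yz (*-monoʳ-≤ 0≤z y≤x)) ⟩
    y * z - y * z  ≈⟨ -‿inverseʳ _ ⟩
    0#             ∎)))

  0≤x² : ∀ x → 0# ≤ x * x
  0≤x² x with total 0# x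
  ... | inj₁ 0≤x = *-nonNegative 0≤x 0≤x
  ... | inj₂ x≤0 = ≤-respʳ-≈ (solve 1 (λ x → (con (+ 0) :- x) :* (con (+ 0) :- x) := x :* x) refl x)
                     (*-nonNegative (≤⇒0≤- x≤0) (≤⇒0≤- x≤0))

  0≤1 : 0# ≤ 1#
  0≤1 = ≤-respʳ-≈ (*-identityˡ 1#) (0≤x² 1#)

  1≉0 : ¬ 1# ≈ 0#
  1≉0 = 0≉1 ∘ sym

  x+y≈0⇒x≈0 : ∀ {x y} → 0# ≤ x → 0# ≤ y → x + y ≈ 0# → x ≈ 0#
  x+y≈0⇒x≈0 {x} {y} 0≤x 0≤y x+y≈0 = antisym
    (≤-respˡ-≈ (+-identityʳ x) (≤-respʳ-≈ x+y≈0 (+-mono-≤ (≤-refl {x}) 0≤y))) 0≤x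

  1+x≉0 : ∀ {x} → 0# ≤ x → ¬ 1# + x ≈ 0#
  1+x≉0 0≤x eq = 1≉0 (x+y≈0⇒x≈0 0≤1 0≤x eq)

  0≤x⁻¹ : ∀ {x y} → 0# ≤ x → x * y ≈ 1# → 0# ≤ y
  0≤x⁻¹ {x} {y} 0≤x xy≈1 = ≤-respʳ-≈ (begin
    x * (y * y)  ≈⟨ *-assoc _ _ _ ⟨
    x * y * y    ≈⟨ *-congʳ xy≈1 ⟩
    1# * y       ≈⟨ *-identityˡ y ⟩
    y            ∎) (*-nonNegative 0≤x (0≤x² y))

  infix 4 _≋_
  _≋_ : ∀ {n} → Vec n → Vec n → Set ℓ₁
  x ≋ y = ∀ i → x i ≈ y i

  -- Opaque, so that the length of a sum can be inferred by unification.

  opaque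
    ∑ : ∀ {n} → Vec n → Carrier
    ∑ = Sum.sum

    ∑≈sum : ∀ {n} (x : Vec n) → ∑ x ≈ Sum.sum x
    ∑≈sum x = refl

    ∑-zero : (x : Vec 0) → ∑ x ≈ 0#
    ∑-zero x = refl

    ∑-suc : ∀ {n} (x : Vec (suc n)) → ∑ x ≈ x zero + ∑ (x ∘ suc)
    ∑-suc x = refl

    ∑-cong : ∀ {n} {x y : Vec n} → x ≋ y → ∑ x ≈ ∑ y
    ∑-cong {n} = Sum.sum-cong-≋ {n}

    ∑-+ : ∀ {n} (x y : Vec n) → ∑ (λ i → x i + y i) ≈ ∑ x + ∑ y
    ∑-+ = Sum.∑-distrib-+

    ∑-swap : ∀ {m n} (f : Fin m → Fin n → Carrier) → ∑ (λ i → ∑ λ j → f i j) ≈ ∑ (λ j → ∑ λ i → f i j)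
    ∑-swap = Sum.∑-comm

    *-∑ : ∀ {n} a (x : Vec n) → a * ∑ x ≈ ∑ (λ i → a * x i)
    *-∑ = Sum.*-distribˡ-sum

    ∑-* : ∀ {n} a (x : Vec n) → ∑ x * a ≈ ∑ (λ i → x i * a)
    ∑-* = Sum.*-distribʳ-sum

    ∑-≈0 : ∀ {n} {x : Vec n} → (∀ i → x i ≈ 0#) → ∑ x ≈ 0#
    ∑-≈0 {n} x≈0 = trans (Sum.sum-cong-≋ x≈0) (Sum.sum-replicate-zero n)

  ∑-nonNegative : ∀ {n} (x : Vec n) → (∀ i → 0# ≤ x i) → 0# ≤ ∑ x
  ∑-nonNegative {zero}  x 0≤x = ≤-reflexive (sym (∑-zero x))
  ∑-nonNegative {suc n} x 0≤x = ≤-respʳ-≈ (sym (∑-suc x)) (+-nonNegative (0≤x zero) (∑-nonNegative (x ∘ suc) (0≤x ∘ suc)))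

  ∑≈0⇒≈0 : ∀ {n} (x : Vec n) → (∀ i → 0# ≤ x i) → ∑ x ≈ 0# → ∀ i → x i ≈ 0#
  ∑≈0⇒≈0 x 0≤x ∑≈0 zero    = x+y≈0⇒x≈0 (0≤x zero) (∑-nonNegative (x ∘ suc) (0≤x ∘ suc)) (trans (sym (∑-suc x)) ∑≈0)
  ∑≈0⇒≈0 x 0≤x ∑≈0 (suc i) = ∑≈0⇒≈0 (x ∘ suc) (0≤x ∘ suc)
    (x+y≈0⇒x≈0 (∑-nonNegative (x ∘ suc) (0≤x ∘ suc)) (0≤x zero) (trans (+-comm _ _) (trans (sym (∑-suc x)) ∑≈0))) i

  ∑-mono-≤ : ∀ {n} {x y : Vec n} → (∀ i → x i ≤ y i) → ∑ x ≤ ∑ y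
  ∑-mono-≤ {zero}  x≤y = ≤-reflexive (trans (∑-zero _) (sym (∑-zero _)))
  ∑-mono-≤ {suc n} x≤y = ≤-respˡ-≈ (sym (∑-suc _)) (≤-respʳ-≈ (sym (∑-suc _)) (+-mono-≤ (x≤y zero) (∑-mono-≤ (x≤y ∘ suc))))

  infixl 6 _⊕_
  infixl 7 _⊙_
  _⊕_ : ∀ {n} → Vec n → Vec n → Vec n
  (x ⊕ y) i = x i + y i

  _⊙_ : ∀ {n} → Carrier → Vec n → Vec n
  (a ⊙ x) i = a * x i

  𝟎 : ∀ {n} → Vec n
  𝟎 _ = 0#

  ⟨_,_⟩ : ∀ {n} → Vec n → Vec n → Carrier
  ⟨ x , y ⟩ = ∑ λ i → x i * y i

  infixr 7 _▹_
  _▹_ : ∀ {m n} → (Fin m → Fin n → Carrier) → Vec n → Vec m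
  (A ▹ x) i = ⟨ A i , x ⟩

  ⟨⟩-cong : ∀ {n} {x x′ y y′ : Vec n} → x ≋ x′ → y ≋ y′ → ⟨ x , y ⟩ ≈ ⟨ x′ , y′ ⟩
  ⟨⟩-cong x≋x′ y≋y′ = ∑-cong λ i → *-cong (x≋x′ i) (y≋y′ i)

  ⟨⟩-comm : ∀ {n} (x y : Vec n) → ⟨ x , y ⟩ ≈ ⟨ y , x ⟩
  ⟨⟩-comm x y = ∑-cong λ i → *-comm (x i) (y i)

  ⟨⟩-⊕ʳ : ∀ {n} (x y z : Vec n) → ⟨ x , y ⊕ z ⟩ ≈ ⟨ x , y ⟩ + ⟨ x , z ⟩
  ⟨⟩-⊕ʳ x y z = trans (∑-cong λ i → distribˡ (x i) (y i) (z i)) (∑-+ _ _)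

  ⟨⟩-⊙ʳ : ∀ {n} a (x y : Vec n) → ⟨ x , a ⊙ y ⟩ ≈ a * ⟨ x , y ⟩
  ⟨⟩-⊙ʳ a x y = trans (∑-cong λ i → solve 3 (λ x a y → x :* (a :* y) := a :* (x :* y)) refl (x i) a (y i))
    (sym (*-∑ a _))

  ⟨⟩-⊕ˡ : ∀ {n} (x y z : Vec n) → ⟨ x ⊕ y , z ⟩ ≈ ⟨ x , z ⟩ + ⟨ y , z ⟩
  ⟨⟩-⊕ˡ x y z = trans (⟨⟩-comm _ _) (trans (⟨⟩-⊕ʳ z x y) (+-cong (⟨⟩-comm _ _) (⟨⟩-comm _ _)))

  ⟨⟩-⊙ˡ : ∀ {n} a (x y : Vec n) → ⟨ a ⊙ x , y ⟩ ≈ a * ⟨ x , y ⟩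
  ⟨⟩-⊙ˡ a x y = trans (⟨⟩-comm _ _) (trans (⟨⟩-⊙ʳ a y x) (*-congˡ (⟨⟩-comm _ _)))

  ⟨⟩-zeroʳ : ∀ {n} (x : Vec n) {y} → y ≋ 𝟎 → ⟨ x , y ⟩ ≈ 0#
  ⟨⟩-zeroʳ x y≋0 = ∑-≈0 λ i → trans (*-congˡ (y≋0 i)) (zeroʳ (x i))

  ⟨⟩-zeroˡ : ∀ {n} {x} (y : Vec n) → x ≋ 𝟎 → ⟨ x , y ⟩ ≈ 0#
  ⟨⟩-zeroˡ y x≋0 = trans (⟨⟩-comm _ _) (⟨⟩-zeroʳ y x≋0)

  0≤⟨x,x⟩ : ∀ {n} (x : Vec n) → 0# ≤ ⟨ x , x ⟩
  0≤⟨x,x⟩ x = ∑-nonNegative _ λ i → 0≤x² (x i)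

  ⟨x,x⟩≈0⇒x≋0 : ∀ {n} (x : Vec n) → ⟨ x , x ⟩ ≈ 0# → x ≋ 𝟎
  ⟨x,x⟩≈0⇒x≋0 x eq i with ≈0? (x i)
  ... | yes xi≈0 = xi≈0
  ... | no  xi≉0 = x*y≈0⇒y≈0 xi≉0 (∑≈0⇒≈0 _ (λ i → 0≤x² (x i)) eq i)

  ⟨x,x⟩≉0 : ∀ {n} (x : Vec n) → NonZeroVec x → ¬ ⟨ x , x ⟩ ≈ 0#
  ⟨x,x⟩≉0 x x≉0 eq = x≉0 (⟨x,x⟩≈0⇒x≋0 x eq)

  nonZeroEntry : ∀ {n} (x : Vec n) → NonZeroVec x → ∃[ i ] ¬ x i ≈ 0#
  nonZeroEntry {zero} x x≉0 = contradiction (λ ()) x≉0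
  nonZeroEntry {suc n} x x≉0 with ≈0? (x zero)
  ... | no  x₀≉0 = zero , x₀≉0
  ... | yes x₀≈0 with nonZeroEntry (x ∘ suc) (λ h → x≉0 λ { zero → x₀≈0 ; (suc i) → h i })
  ...   | i , xi≉0 = suc i , xi≉0

  zeroVec? : ∀ {n} (x : Vec n) → Dec (x ≋ 𝟎)
  zeroVec? x = map′ lower lift (decide (Lift c (x ≋ 𝟎)))

  ▹-cong : ∀ {m n} (A : Fin m → Fin n → Carrier) {x y} → x ≋ y → A ▹ x ≋ A ▹ y
  ▹-cong A x≋y i = ⟨⟩-cong (λ j → refl) x≋y

  ▹-⊕ : ∀ {m n} (A : Fin m → Fin n → Carrier) x y → A ▹ (x ⊕ y) ≋ A ▹ x ⊕ A ▹ y
  ▹-⊕ A x y i = ⟨⟩-⊕ʳ (A i) x y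

  ▹-⊙ : ∀ {m n} (A : Fin m → Fin n → Carrier) a x → A ▹ (a ⊙ x) ≋ a ⊙ (A ▹ x)
  ▹-⊙ A a x i = ⟨⟩-⊙ʳ a (A i) x

  ⟨▹,⟩ : ∀ {m n} (A : Fin m → Fin n → Carrier) x y → ⟨ A ▹ x , y ⟩ ≈ ⟨ x , (λ j i → A i j) ▹ y ⟩
  ⟨▹,⟩ {m} {n} A x y = begin
    ∑ (λ i → ∑ (λ j → A i j * x j) * y i)   ≈⟨ ∑-cong (λ i → ∑-* (y i) _) ⟩
    ∑ (λ i → ∑ λ j → A i j * x j * y i)     ≈⟨ ∑-swap _ ⟩
    ∑ (λ j → ∑ λ i → A i j * x j * y i)     ≈⟨ ∑-cong (λ j → trans (∑-cong λ i → solve 3 (λ a x y → a :* x :* y := x :* (a :* y)) refl (A i j) (x j) (y i)) (sym (*-∑ (x j) _))) ⟩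
    ∑ (λ j → x j * ∑ λ i → A i j * y i)     ∎

  ⟨⟩-suc : ∀ {n} (x y : Vec (suc n)) → ⟨ x , y ⟩ ≈ x zero * y zero + ⟨ x ∘ suc , y ∘ suc ⟩
  ⟨⟩-suc x y = ∑-suc _

  -- Linear systems and quadratic forms

  ⟨⟩-combineʳ : ∀ {m n} (x : Vec n) (a : Vec m) (Y : Fin m → Vec n) →
                ⟨ x , (λ j → ∑ λ p → a p * Y p j) ⟩ ≈ ∑ (λ p → a p * ⟨ x , Y p ⟩)
  ⟨⟩-combineʳ x a Y = begin
    ∑ (λ j → x j * ∑ (λ p → a p * Y p j))    ≈⟨ ∑-cong (λ j → *-∑ (x j) _) ⟩
    ∑ (λ j → ∑ λ p → x j * (a p * Y p j))    ≈⟨ ∑-swap _ ⟩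
    ∑ (λ p → ∑ λ j → x j * (a p * Y p j))    ≈⟨ ∑-cong (λ p → ⟨⟩-⊙ʳ (a p) x (Y p)) ⟩
    ∑ (λ p → a p * ⟨ x , Y p ⟩)              ∎

  ⟨⟩-combineˡ : ∀ {m n} (x : Vec n) (a : Vec m) (Y : Fin m → Vec n) →
                ⟨ (λ j → ∑ λ p → a p * Y p j) , x ⟩ ≈ ∑ (λ p → a p * ⟨ Y p , x ⟩)
  ⟨⟩-combineˡ x a Y = trans (⟨⟩-comm _ _) (trans (⟨⟩-combineʳ x a Y) (∑-cong λ p → *-congˡ (⟨⟩-comm _ _)))

  -- Gaussian elimination by induction on the number of equations. If the first column vanishes, the
  -- first basis vector is a solution; otherwise a pivot row `i₀` eliminates the first unknown from
  -- the other rows.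
  homogeneousSystem : ∀ {m n} → m ℕ.< n → (M : Fin m → Fin n → Carrier) →
                      ∃[ x ] NonZeroVec x × M ▹ x ≋ 𝟎
  homogeneousSystem {zero} {suc n} _ M = (λ _ → 1#) , (λ h → 1≉0 (h zero)) , λ ()
  homogeneousSystem {suc m} {suc n} m<n M with zeroVec? (λ i → M i zero)
  ... | yes col≋0 = e₀ , (λ h → 1≉0 (h zero)) , λ i → begin
    ⟨ M i , e₀ ⟩                             ≈⟨ ⟨⟩-suc (M i) e₀ ⟩
    M i zero * 1# + ⟨ M i ∘ suc , 𝟎 ⟩        ≈⟨ +-cong (*-congʳ (col≋0 i)) (⟨⟩-zeroʳ (M i ∘ suc) (λ _ → refl)) ⟩
    0# * 1# + 0#                             ≈⟨ trans (+-identityʳ _) (zeroˡ 1#) ⟩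
    0#                                       ∎
    where
    e₀ : Vec (suc n)
    e₀ zero    = 1#
    e₀ (suc _) = 0#
  ... | no col≉0 with nonZeroEntry (λ i → M i zero) col≉0
  ... | i₀ , p≉0 with homogeneousSystem (ℕ.s<s⁻¹ m<n) M′
    where
    M′ : Fin m → Fin n → Carrier
    -- Elimination without division: the pivot times the other row, minus that row's leading entry
    -- times the pivot row.
    M′ j k = M i₀ zero * M (punchIn i₀ j) (suc k) + - M (punchIn i₀ j) zero * M i₀ (suc k)
  ... | y , y≉0 , M′y≋0 = x , x≉0 , λ i → case i₀ ≟ i of λ
    { (yes ≡.refl) → begin
        ⟨ M i₀ , x ⟩                     ≈⟨ row i₀ ⟩
        p * - r + p * r                  ≈⟨ solve 2 (λ p r → p :* (:- r) :+ p :* r := con (+ 0)) refl p r ⟩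
        0#                               ∎
    ; (no i₀≢i) → ≡.subst (λ j → ⟨ M j , x ⟩ ≈ 0#) (punchIn-punchOut i₀≢i) (otherRow (punchOut i₀≢i)) }
    where
    p = M i₀ zero
    r = ⟨ M i₀ ∘ suc , y ⟩
    x : Vec (suc n)
    -- With the tail scaled by the pivot `p`, the value `- r` solves the pivot row, again without
    -- division.
    x zero    = - r
    x (suc k) = p * y k
    x≉0 : NonZeroVec x
    x≉0 h = y≉0 λ k → x*y≈0⇒y≈0 p≉0 (h (suc k))
    row : ∀ i → ⟨ M i , x ⟩ ≈ M i zero * - r + p * ⟨ M i ∘ suc , y ⟩
    row i = trans (⟨⟩-suc (M i) x) (+-congˡ (⟨⟩-⊙ʳ p (M i ∘ suc) y))
    otherRow : ∀ j → ⟨ M (punchIn i₀ j) , x ⟩ ≈ 0#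
    otherRow j = begin
      ⟨ M i , x ⟩                                                ≈⟨ row i ⟩
      M i zero * - r + p * s                                     ≈⟨ solve 4 (λ q p r s → q :* (:- r) :+ p :* s := p :* s :+ (:- q) :* r) refl (M i zero) p r s ⟩
      p * s + - M i zero * r                                     ≈⟨ +-cong (⟨⟩-⊙ˡ p _ y) (⟨⟩-⊙ˡ (- M i zero) _ y) ⟨
      ⟨ p ⊙ (M i ∘ suc) , y ⟩ + ⟨ - M i zero ⊙ (M i₀ ∘ suc) , y ⟩  ≈⟨ ⟨⟩-⊕ˡ _ _ y ⟨
      ⟨ p ⊙ (M i ∘ suc) ⊕ - M i zero ⊙ (M i₀ ∘ suc) , y ⟩          ≈⟨ M′y≋0 j ⟩
      0#                                                         ∎
      where
      i = punchIn i₀ j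
      s = ⟨ M i ∘ suc , y ⟩

  δ : ∀ {n} → Matrix n
  δ zero    zero    = 1#
  δ zero    (suc j) = 0#
  δ (suc i) zero    = 0#
  δ (suc i) (suc j) = δ i j

  δ▹ : ∀ {n} (x : Vec n) → δ ▹ x ≋ x
  δ▹ x zero = begin
    ⟨ δ zero , x ⟩               ≈⟨ ⟨⟩-suc (δ zero) x ⟩
    1# * x zero + ⟨ 𝟎 , x ∘ suc ⟩  ≈⟨ +-cong (*-identityˡ _) (⟨⟩-zeroˡ _ (λ _ → refl)) ⟩
    x zero + 0#                  ≈⟨ +-identityʳ _ ⟩
    x zero                       ∎
  δ▹ x (suc i) = begin
    ⟨ δ (suc i) , x ⟩                    ≈⟨ ⟨⟩-suc (δ (suc i)) x ⟩
    0# * x zero + ⟨ δ i , x ∘ suc ⟩      ≈⟨ +-cong (zeroˡ _) (δ▹ (x ∘ suc) i) ⟩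
    0# + x (suc i)                       ≈⟨ +-identityˡ _ ⟩
    x (suc i)                            ∎

  δ-sym : ∀ {n} (i j : Fin n) → δ i j ≈ δ j i
  δ-sym zero    zero    = refl
  δ-sym zero    (suc j) = refl
  δ-sym (suc i) zero    = refl
  δ-sym (suc i) (suc j) = δ-sym i j

  ⟨,▹⟩-symmetric : ∀ {n} (A : Matrix n) → Symmetric A → ∀ x y → ⟨ x , A ▹ y ⟩ ≈ ⟨ A ▹ x , y ⟩
  ⟨,▹⟩-symmetric A A-sym x y = sym (trans (⟨▹,⟩ A x y) (⟨⟩-cong (λ _ → refl) λ i → ⟨⟩-cong (λ j → A-sym j i) (λ _ → refl)))

  x²≤⟨x,x⟩ : ∀ {n} (x : Vec n) i → x i * x i ≤ ⟨ x , x ⟩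
  x²≤⟨x,x⟩ x zero = ≤-respˡ-≈ (+-identityʳ _) (≤-respʳ-≈ (sym (⟨⟩-suc x x)) (+-mono-≤ ≤-refl (0≤⟨x,x⟩ (x ∘ suc))))
  x²≤⟨x,x⟩ x (suc i) = ≤-respˡ-≈ (+-identityˡ _) (≤-respʳ-≈ (sym (⟨⟩-suc x x)) (+-mono-≤ (0≤x² _) (x²≤⟨x,x⟩ (x ∘ suc) i)))

  -- The difference of the two sides is (x - y)² + xy and also x² + y² - xy; the sign of xy decides
  -- which of them is a sum of nonnegative terms.
  xy≤x²+y² : ∀ x y → x * y ≤ x * x + y * y
  xy≤x²+y² x y = 0≤-⇒≤ (case total 0# (x * y) of λ
    { (inj₁ 0≤xy) → ≤-respʳ-≈ (solve 2 (λ x y → (x :- y) :* (x :- y) :+ x :* y := x :* x :+ y :* y :- x :* y) refl x y)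
        (+-nonNegative (0≤x² (x - y)) 0≤xy)
    ; (inj₂ xy≤0) → ≤-respʳ-≈ (solve 2 (λ x y → x :* x :+ y :* y :+ (con (+ 0) :- x :* y) := x :* x :+ y :* y :- x :* y) refl x y)
        (+-nonNegative (+-nonNegative (0≤x² x) (0≤x² y)) (≤⇒0≤- xy≤0)) })

  -- A crude bound suffices: each term of the double sum is at most the sum of the squares of `x i`
  -- and `A i j * x j`, and the square of a coordinate is at most `⟨ x , x ⟩`.
  quadraticForm-bounded : ∀ {n} (A : Matrix n) → ∃[ K ] 0# ≤ K × (∀ x → ⟨ x , A ▹ x ⟩ ≤ K * ⟨ x , x ⟩)
  quadraticForm-bounded A = K , 0≤K , bound
    where
    K = ∑ λ i → ∑ λ j → 1# + A i j * A i j
    0≤K : 0# ≤ K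
    0≤K = ∑-nonNegative _ λ i → ∑-nonNegative _ λ j → +-nonNegative 0≤1 (0≤x² _)
    bound : ∀ x → ⟨ x , A ▹ x ⟩ ≤ K * ⟨ x , x ⟩
    bound x = ≤-respˡ-≈ (sym (∑-cong λ i → *-∑ (x i) _)) (≤-respʳ-≈ (sym (trans (∑-* n _) (∑-cong λ i → ∑-* n _)))
      (∑-mono-≤ λ i → ∑-mono-≤ λ j → term i j))
      where
      n = ⟨ x , x ⟩
      term : ∀ i j → x i * (A i j * x j) ≤ (1# + A i j * A i j) * n
      term i j = ≤-trans (xy≤x²+y² (x i) (A i j * x j))
        (≤-respʳ-≈ (solve 2 (λ n a → n :+ n :* (a :* a) := (con (+ 1) :+ a :* a) :* n) refl n (A i j))
        (+-mono-≤ (x²≤⟨x,x⟩ x i)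
        (≤-respˡ-≈ (solve 2 (λ a x → x :* x :* (a :* a) := a :* x :* (a :* x)) refl (A i j) (x j))
          (*-monoʳ-≤ (0≤x² (A i j)) (x²≤⟨x,x⟩ x j)))))

  -- Both mixed terms reduce to `⟨ x , x ⟩`, one directly from `B ▹ y ≋ x` and the other through the
  -- symmetry of `B`.
  quadraticForm-⊕ : ∀ {n} (B : Matrix n) → Symmetric B → ∀ x y a → B ▹ y ≋ x →
    ⟨ x ⊕ a ⊙ y , B ▹ (x ⊕ a ⊙ y) ⟩ ≈ ⟨ x , B ▹ x ⟩ + a * ⟨ x , x ⟩ + a * (⟨ x , x ⟩ + a * ⟨ x , y ⟩)
  quadraticForm-⊕ B B-sym x y a By≋x = begin
    ⟨ x ⊕ a ⊙ y , B ▹ (x ⊕ a ⊙ y) ⟩                          ≈⟨ ⟨⟩-cong (λ _ → refl) B▹z ⟩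
    ⟨ x ⊕ a ⊙ y , B ▹ x ⊕ a ⊙ x ⟩                            ≈⟨ ⟨⟩-⊕ˡ x (a ⊙ y) _ ⟩
    ⟨ x , B ▹ x ⊕ a ⊙ x ⟩ + ⟨ a ⊙ y , B ▹ x ⊕ a ⊙ x ⟩        ≈⟨ +-cong left right ⟩
    ⟨ x , B ▹ x ⟩ + a * ⟨ x , x ⟩ + a * (⟨ x , x ⟩ + a * ⟨ x , y ⟩)   ∎
    where
    B▹z : B ▹ (x ⊕ a ⊙ y) ≋ B ▹ x ⊕ a ⊙ x
    B▹z i = trans (▹-⊕ B x (a ⊙ y) i) (+-congˡ (trans (▹-⊙ B a y i) (*-congˡ (By≋x i))))
    left : ⟨ x , B ▹ x ⊕ a ⊙ x ⟩ ≈ ⟨ x , B ▹ x ⟩ + a * ⟨ x , x ⟩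
    left = trans (⟨⟩-⊕ʳ x (B ▹ x) (a ⊙ x)) (+-congˡ (⟨⟩-⊙ʳ a x x))
    ⟨y,Bx⟩ : ⟨ y , B ▹ x ⟩ ≈ ⟨ x , x ⟩
    ⟨y,Bx⟩ = trans (⟨,▹⟩-symmetric B B-sym y x) (⟨⟩-cong By≋x (λ _ → refl))
    right : ⟨ a ⊙ y , B ▹ x ⊕ a ⊙ x ⟩ ≈ a * (⟨ x , x ⟩ + a * ⟨ x , y ⟩)
    right = trans (⟨⟩-⊙ˡ a y _) (*-congˡ (trans (⟨⟩-⊕ʳ y (B ▹ x) (a ⊙ x)) (+-cong ⟨y,Bx⟩ (trans (⟨⟩-⊙ʳ a y x) (*-congˡ (⟨⟩-comm y x))))))

  -- In `coercive`, `f`, `q` and `s` are `⟨ x , B ▹ x ⟩`, `⟨ x , x ⟩` and `⟨ x , C ▹ x ⟩`. The last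
  -- summand cancels the term in `s`, and `(1# + K) * t ≈ 1#` reduces what it adds to `t * q`.
  completeSquare : ∀ {t K} → (1# + K) * t ≈ 1# → ∀ f q s →
    f + - t * q + - t * (q + - t * s) + t * t * (q + (K * q - s)) ≈ f - t * q
  completeSquare {t} {K} inv f q s = begin
    f + - t * q + - t * (q + - t * s) + t * t * (q + (K * q - s))
      ≈⟨ +-congˡ (solve 4 (λ t q K s → t :* t :* (q :+ (K :* q :- s)) := (con (+ 1) :+ K) :* t :* (t :* q) :- t :* t :* s) refl t q K s) ⟩
    f + - t * q + - t * (q + - t * s) + ((1# + K) * t * (t * q) - t * t * s)
      ≈⟨ +-congˡ (+-congʳ (trans (*-congʳ inv) (*-identityˡ _))) ⟩
    f + - t * q + - t * (q + - t * s) + (t * q - t * t * s)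
      ≈⟨ solve 4 (λ f t q s → f :+ (:- t) :* q :+ (:- t) :* (q :+ (:- t) :* s) :+ (t :* q :- t :* t :* s) := f :- t :* q) refl f t q s ⟩
    f - t * q ∎

  -- Invariant subspaces and polynomials in a matrix

  record Subspace (n : ℕ) : Set (Level.suc (c ⊔ ℓ₁)) where
    field
      Member      : Vec n → Set (c ⊔ ℓ₁)
      ⊕-closed    : ∀ {x y} → Member x → Member y → Member (x ⊕ y)
      ⊙-closed    : ∀ a {x} → Member x → Member (a ⊙ x)
      Member-resp : ∀ {x y} → x ≋ y → Member x → Member y

  module Restriction {n} (W : Subspace n) (B : Matrix n)
                     (B-invariant : ∀ {x} → Subspace.Member W x → Subspace.Member W (B ▹ x)) where

    open Subspace W

    pow : ℕ → Matrix n
    pow zero    = δ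
    pow (suc k) = λ i j → ∑ λ l → B i l * pow k l j

    pow-suc : ∀ k x → pow (suc k) ▹ x ≋ B ▹ pow k ▹ x
    pow-suc k x i = ⟨⟩-combineˡ x (B i) (pow k)

    poly : ∀ {d} → Vec d → Vec n → Vec n
    poly a x i = ∑ λ p → a p * (pow (toℕ p) ▹ x) i

    polyMatrix : ∀ {d} → Vec d → Matrix n
    polyMatrix a i j = ∑ λ p → a p * pow (toℕ p) i j

    polyMatrix-▹ : ∀ {d} (a : Vec d) x → polyMatrix a ▹ x ≋ poly a x
    polyMatrix-▹ a x i = ⟨⟩-combineˡ x a (λ p → pow (toℕ p) i)

    poly-suc : ∀ {d} (a : Vec (suc d)) x → poly a x ≋ a zero ⊙ x ⊕ B ▹ poly (a ∘ suc) x
    poly-suc a x i = begin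
      poly a x i
        ≈⟨ ∑-suc _ ⟩
      a zero * (δ ▹ x) i + ∑ (λ p → a (suc p) * (pow (suc (toℕ p)) ▹ x) i)
        ≈⟨ +-cong (*-congˡ (δ▹ x i)) (∑-cong λ p → *-congˡ (pow-suc (toℕ p) x i)) ⟩
      a zero * x i + ∑ (λ p → a (suc p) * (B ▹ pow (toℕ p) ▹ x) i)
        ≈⟨ +-congˡ (⟨⟩-combineʳ (B i) (a ∘ suc) (λ p → pow (toℕ p) ▹ x)) ⟨
      (a zero ⊙ x ⊕ B ▹ poly (a ∘ suc) x) i
        ∎

    poly-member : ∀ {d} (a : Vec d) {x} → Member x → Member (poly a x)
    poly-member {zero}  a {x} x∈W = Member-resp (λ i → trans (zeroˡ (x i)) (sym (∑-zero _))) (⊙-closed 0# x∈W)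
    poly-member {suc d} a {x} x∈W = Member-resp (λ i → sym (poly-suc a x i)) (⊕-closed (⊙-closed (a zero) x∈W) (B-invariant (poly-member (a ∘ suc) x∈W)))

    -- A relation among n² + 1 powers of `B` amounts to n² homogeneous equations, one per matrix
    -- entry, in n² + 1 unknown coefficients. `remQuot` and `combine` number the entries.
    annihilatingPolynomial : ∃[ a ] NonZeroVec a × (∀ x → poly {suc (n ℕ.* n)} a x ≋ 𝟎)
    annihilatingPolynomial with homogeneousSystem (ℕ.n<1+n (n ℕ.* n))
                                  (λ ij p → pow (toℕ p) (proj₁ (remQuot {n} n ij)) (proj₂ (remQuot {n} n ij)))
    ... | a , a≉0 , h = a , a≉0 , λ x i → begin
      poly a x i              ≈⟨ polyMatrix-▹ a x i ⟨
      (polyMatrix a ▹ x) i    ≈⟨ ⟨⟩-zeroˡ x (λ j → trans (∑-cong λ p → *-comm _ _)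
                                  (≡.subst (λ (k , l) → ∑ (λ p → pow (toℕ p) k l * a p) ≈ 0#) (remQuot-combine {n} {n} i j) (h (combine i j)))) ⟩
      0#                      ∎

    module _ (B-injective : ∀ {x} → Member x → B ▹ x ≋ 𝟎 → x ≋ 𝟎) where

      -- Cancelling powers of B, an annihilating polynomial can be taken with nonzero constant term.
      annihilator-unit : ∀ {d} (a : Vec d) → NonZeroVec a → (∀ {x} → Member x → poly a x ≋ 𝟎) →
        ∃[ e ] Σ[ b ∈ Vec e ] ∃[ a₀ ] ¬ a₀ ≈ 0# × (∀ {x} → Member x → a₀ ⊙ x ⊕ B ▹ poly b x ≋ 𝟎)
      annihilator-unit {zero}  a a≉0 h = contradiction (λ ()) a≉0
      annihilator-unit {suc d} a a≉0 h with ≈0? (a zero)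
      ... | no  a₀≉0 = d , a ∘ suc , a zero , a₀≉0 , λ {x} x∈W i → trans (sym (poly-suc a x i)) (h x∈W i)
      ... | yes a₀≈0 = annihilator-unit (a ∘ suc) (λ z → a≉0 λ { zero → a₀≈0 ; (suc p) → z p })
        λ {x} x∈W → B-injective (poly-member (a ∘ suc) x∈W) λ i → begin
          (B ▹ poly (a ∘ suc) x) i                    ≈⟨ +-identityˡ _ ⟨
          0# + (B ▹ poly (a ∘ suc) x) i               ≈⟨ +-congʳ (trans (*-congʳ a₀≈0) (zeroˡ (x i))) ⟨
          a zero * x i + (B ▹ poly (a ∘ suc) x) i     ≈⟨ poly-suc a x i ⟨
          poly a x i                                  ≈⟨ h x∈W i ⟩
          0#                                          ∎

      -- The relation from `annihilator-unit` is solved for `x` by dividing by `a₀`. Being a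
      -- polynomial in `B`, the inverse `C` preserves `W`.
      rightInverse : Σ[ C ∈ Matrix n ] (∀ {x} → Member x → Member (C ▹ x) × B ▹ C ▹ x ≋ x)
      rightInverse with annihilatingPolynomial
      ... | a , a≉0 , h with annihilator-unit a a≉0 (λ {x} _ → h x)
      ... | e , b , a₀ , a₀≉0 , h′ with invertible a₀ a₀≉0
      ... | a₀⁻¹ , inv = C , λ {x} x∈W → Member-resp (λ i → sym (C▹ x i)) (⊙-closed (- a₀⁻¹) (poly-member b x∈W)) , λ i → begin
        (B ▹ C ▹ x) i                           ≈⟨ ▹-cong B (C▹ x) i ⟩
        (B ▹ (- a₀⁻¹ ⊙ poly b x)) i             ≈⟨ ▹-⊙ B (- a₀⁻¹) (poly b x) i ⟩
        - a₀⁻¹ * (B ▹ poly b x) i               ≈⟨ solve 4 (λ a z x w → (:- z) :* w := z :* (a :* x :- (a :* x :+ w))) refl a₀ a₀⁻¹ (x i) _ ⟩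
        a₀⁻¹ * (a₀ * x i - (a₀ * x i + (B ▹ poly b x) i))  ≈⟨ *-congˡ (+-congˡ (-‿cong (h′ x∈W i))) ⟩
        a₀⁻¹ * (a₀ * x i - 0#)                  ≈⟨ solve 3 (λ a z x → z :* (a :* x :- con (+ 0)) := a :* z :* x) refl a₀ a₀⁻¹ (x i) ⟩
        a₀ * a₀⁻¹ * x i                         ≈⟨ trans (*-congʳ inv) (*-identityˡ _) ⟩
        x i                                     ∎
        where
        C : Matrix n
        C i = - a₀⁻¹ ⊙ polyMatrix b i
        C▹ : ∀ x → C ▹ x ≋ - a₀⁻¹ ⊙ poly b x
        C▹ x i = trans (⟨⟩-⊙ˡ (- a₀⁻¹) (polyMatrix b i) x) (*-congˡ (polyMatrix-▹ b x i))

      -- Expand 0 ≤ ⟨ z , B z ⟩ for z = x - t C x, where C inverts B and t⁻¹ = 1 + K with ⟨ x , C x ⟩ ≤ K ⟨ x , x ⟩.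
      coercive : Symmetric B → (∀ {x} → Member x → 0# ≤ ⟨ x , B ▹ x ⟩) →
        ∃[ t ] 0# ≤ t × ¬ t ≈ 0# × (∀ {x} → Member x → t * ⟨ x , x ⟩ ≤ ⟨ x , B ▹ x ⟩)
      coercive B-sym B-psd = t , 0≤x⁻¹ (+-nonNegative 0≤1 0≤K) inv , t≉0 , bound
        where
        C = proj₁ rightInverse
        K = proj₁ (quadraticForm-bounded C)
        0≤K = proj₁ (proj₂ (quadraticForm-bounded C))
        t = proj₁ (invertible (1# + K) (1+x≉0 0≤K))
        inv = proj₂ (invertible (1# + K) (1+x≉0 0≤K))
        t≉0 : ¬ t ≈ 0#
        t≉0 t≈0 = 1≉0 (trans (sym inv) (trans (*-congˡ t≈0) (zeroʳ _)))
        bound : ∀ {x} → Member x → t * ⟨ x , x ⟩ ≤ ⟨ x , B ▹ x ⟩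
        bound {x} x∈W = 0≤-⇒≤ (≤-respʳ-≈ (trans (+-congʳ (quadraticForm-⊕ B B-sym x (C ▹ x) (- t) (proj₂ (proj₂ rightInverse x∈W)))) (completeSquare inv _ _ _)) (+-nonNegative
          (B-psd (⊕-closed x∈W (⊙-closed (- t) (proj₁ (proj₂ rightInverse x∈W)))))
          (*-nonNegative (0≤x² t) (+-nonNegative (0≤⟨x,x⟩ x) (≤⇒0≤- (proj₂ (proj₂ (quadraticForm-bounded C)) x))))))

  -- Eigenvectors of symmetric matrices

  -- The one appeal to completeness: Rayleigh quotients on `W` are bounded by
  -- `quadraticForm-bounded`, and `x₀` provides one.
  rayleighSupremum : ∀ {n} (W : Subspace n) (A : Matrix n) → let open Subspace W in (∃[ x ] Member x × NonZeroVec x) →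
    ∃[ s ] (∀ {x} → Member x → ⟨ x , A ▹ x ⟩ ≤ s * ⟨ x , x ⟩) ×
           (∀ b → (∀ {x} → Member x → ⟨ x , A ▹ x ⟩ ≤ b * ⟨ x , x ⟩) → s ≤ b)
  rayleighSupremum {n} W A (x₀ , x₀∈W , x₀≉0) =
    let K , _ , A-bounded = quadraticForm-bounded A in
    fromSupremum (complete Below (_ , proj₁ (proj₂ (quotient-below x₀∈W x₀≉0))) (K , upperBound K λ {y} _ → A-bounded y))
    where
    open Subspace W

    -- The downward closure of the set of Rayleigh quotients, written without division; it has the
    -- same upper bounds.
    Below : Carrier → Set (c ⊔ ℓ₁ ⊔ ℓ₂)
    Below μ = ∃[ y ] Member y × NonZeroVec y × μ * ⟨ y , y ⟩ ≤ ⟨ y , A ▹ y ⟩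

    quotient-below : ∀ {y} → Member y → NonZeroVec y → ∃[ μ ] Below μ × μ * ⟨ y , y ⟩ ≈ ⟨ y , A ▹ y ⟩
    quotient-below {y} y∈W y≉0 = μ , (y , y∈W , y≉0 , ≤-reflexive μq≈) , μq≈
      where
      q = ⟨ y , y ⟩
      q⁻¹ = invertible q (⟨x,x⟩≉0 y y≉0)
      μ = ⟨ y , A ▹ y ⟩ * proj₁ q⁻¹
      μq≈ : μ * q ≈ ⟨ y , A ▹ y ⟩
      μq≈ = begin
        ⟨ y , A ▹ y ⟩ * proj₁ q⁻¹ * q    ≈⟨ trans (*-assoc _ _ _) (*-congˡ (trans (*-comm _ _) (proj₂ q⁻¹))) ⟩
        ⟨ y , A ▹ y ⟩ * 1#               ≈⟨ *-identityʳ _ ⟩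
        ⟨ y , A ▹ y ⟩                    ∎

    upperBound : ∀ b → (∀ {y} → Member y → ⟨ y , A ▹ y ⟩ ≤ b * ⟨ y , y ⟩) → UpperBound Below b
    upperBound b h μ (y , y∈W , y≉0 , μq≤) = *-cancelʳ-≤ (0≤⟨x,x⟩ y) (⟨x,x⟩≉0 y y≉0) (≤-trans μq≤ (h y∈W))
    fromSupremum : (∃[ s ] UpperBound Below s × (∀ b → UpperBound Below b → s ≤ b)) →
      ∃[ s ] (∀ {x} → Member x → ⟨ x , A ▹ x ⟩ ≤ s * ⟨ x , x ⟩) ×
             (∀ b → (∀ {x} → Member x → ⟨ x , A ▹ x ⟩ ≤ b * ⟨ x , x ⟩) → s ≤ b)
    fromSupremum (s , s-upper , s-least) = s , bound , λ b h → s-least b (upperBound b h)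
      where
      bound : ∀ {x} → Member x → ⟨ x , A ▹ x ⟩ ≤ s * ⟨ x , x ⟩
      bound {x} x∈W with zeroVec? x
      ... | yes x≋0 = ≤-reflexive (trans (⟨⟩-zeroˡ _ x≋0) (sym (trans (*-congˡ (⟨⟩-zeroˡ x x≋0)) (zeroʳ s))))
      ... | no  x≉0 = let μ , μ-below , μq≈ = quotient-below x∈W x≉0 in
        ≤-respˡ-≈ μq≈ (*-monoʳ-≤ (0≤⟨x,x⟩ x) (s-upper μ μ-below))

  -- Otherwise s - A would be coercive on W, and s could be lowered.
  supremum-eigenvalue : ∀ {n} (W : Subspace n) (A : Matrix n) → let open Subspace W in Symmetric A →
    (∀ {x} → Member x → Member (A ▹ x)) → ∀ s →
    (∀ {x} → Member x → ⟨ x , A ▹ x ⟩ ≤ s * ⟨ x , x ⟩) →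
    (∀ b → (∀ {x} → Member x → ⟨ x , A ▹ x ⟩ ≤ b * ⟨ x , x ⟩) → s ≤ b) →
    ¬ (∀ {x} → Member x → A ▹ x ≋ s ⊙ x → x ≋ 𝟎)
  supremum-eigenvalue {n} W A A-sym A-inv s s-upper s-least no-eigenvector =
    lowered (Restriction.coercive W B B-inv B-injective B-sym B-psd)
    where
    open Subspace W

    B : Matrix n
    B i j = s * δ i j + - 1# * A i j

    B-sym : Symmetric B
    B-sym i j = +-cong (*-congˡ (δ-sym i j)) (*-congˡ (A-sym i j))

    B▹ : ∀ x → B ▹ x ≋ s ⊙ x ⊕ - 1# ⊙ (A ▹ x)
    B▹ x i = trans (⟨⟩-⊕ˡ (s ⊙ δ i) (- 1# ⊙ A i) x)
      (+-cong (trans (⟨⟩-⊙ˡ s (δ i) x) (*-congˡ (δ▹ x i))) (⟨⟩-⊙ˡ (- 1#) (A i) x))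

    B-inv : ∀ {x} → Member x → Member (B ▹ x)
    B-inv {x} x∈W = Member-resp (λ i → sym (B▹ x i)) (⊕-closed (⊙-closed s x∈W) (⊙-closed (- 1#) (A-inv x∈W)))

    ⟨x,Bx⟩ : ∀ x → ⟨ x , B ▹ x ⟩ ≈ s * ⟨ x , x ⟩ - ⟨ x , A ▹ x ⟩
    ⟨x,Bx⟩ x = begin
      ⟨ x , B ▹ x ⟩                                ≈⟨ ⟨⟩-cong (λ _ → refl) (B▹ x) ⟩
      ⟨ x , s ⊙ x ⊕ - 1# ⊙ (A ▹ x) ⟩               ≈⟨ ⟨⟩-⊕ʳ x (s ⊙ x) (- 1# ⊙ (A ▹ x)) ⟩
      ⟨ x , s ⊙ x ⟩ + ⟨ x , - 1# ⊙ (A ▹ x) ⟩       ≈⟨ +-cong (⟨⟩-⊙ʳ s x x) (⟨⟩-⊙ʳ (- 1#) x (A ▹ x)) ⟩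
      s * ⟨ x , x ⟩ + - 1# * ⟨ x , A ▹ x ⟩         ≈⟨ +-congˡ (-1*x≈-x _) ⟩
      s * ⟨ x , x ⟩ - ⟨ x , A ▹ x ⟩                ∎

    B-psd : ∀ {x} → Member x → 0# ≤ ⟨ x , B ▹ x ⟩
    B-psd {x} x∈W = ≤-respʳ-≈ (sym (⟨x,Bx⟩ x)) (≤⇒0≤- (s-upper x∈W))

    B-injective : ∀ {x} → Member x → B ▹ x ≋ 𝟎 → x ≋ 𝟎
    B-injective {x} x∈W Bx≋0 = no-eigenvector x∈W λ i → begin
      (A ▹ x) i                                     ≈⟨ solve 2 (λ y a → a := y :- (y :+ (:- con (+ 1)) :* a)) refl (s * x i) ((A ▹ x) i) ⟩
      s * x i - (s * x i + - 1# * (A ▹ x) i)        ≈⟨ +-congˡ (-‿cong (trans (sym (B▹ x i)) (Bx≋0 i))) ⟩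
      s * x i - 0#                                  ≈⟨ trans (+-congˡ -0#≈0#) (+-identityʳ _) ⟩
      s * x i                                       ∎

    lowered : ¬ (∃[ t ] 0# ≤ t × ¬ t ≈ 0# × (∀ {x} → Member x → t * ⟨ x , x ⟩ ≤ ⟨ x , B ▹ x ⟩))
    lowered (t , 0≤t , t≉0 , coercive) = t≉0 (antisym
      (0≤-⇒≤ (≤-respʳ-≈ (solve 2 (λ s t → s :- t :- s := con (+ 0) :- t) refl s t) (≤⇒0≤- s≤s-t))) 0≤t)
      where
      rearrange : ∀ q a → s * q - a - t * q ≈ (s - t) * q - a
      rearrange q a = solve 4 (λ s q a t → s :* q :- a :- t :* q := (s :- t) :* q :- a) refl s q a t
      s≤s-t : s ≤ s - t
      s≤s-t = s-least (s - t) λ {y} y∈W →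
        0≤-⇒≤ (≤-respʳ-≈ (trans (+-congʳ (⟨x,Bx⟩ y)) (rearrange _ _)) (≤⇒0≤- (coercive y∈W)))

  -- The supremum of the Rayleigh quotients is an eigenvalue. Excluded middle turns the negative
  -- conclusion of `supremum-eigenvalue` into an actual vector.
  eigenvector : ∀ {n} (W : Subspace n) (A : Matrix n) → let open Subspace W in Symmetric A →
    (∀ {x} → Member x → Member (A ▹ x)) → (∃[ x ] Member x × NonZeroVec x) →
    ∃[ s ] ∃[ u ] Member u × NonZeroVec u × A ▹ u ≋ s ⊙ u
  eigenvector W A A-sym A-inv nontrivial = fromSupremum (rayleighSupremum W A nontrivial)
    where
    open Subspace W
    fromSupremum : (∃[ s ] (∀ {x} → Member x → ⟨ x , A ▹ x ⟩ ≤ s * ⟨ x , x ⟩) ×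
                           (∀ b → (∀ {x} → Member x → ⟨ x , A ▹ x ⟩ ≤ b * ⟨ x , x ⟩) → s ≤ b)) →
      ∃[ s ] ∃[ u ] Member u × NonZeroVec u × A ▹ u ≋ s ⊙ u
    fromSupremum (s , s-upper , s-least) = choose (decide _)
      where
      choose : Dec (∃[ u ] Member u × NonZeroVec u × A ▹ u ≋ s ⊙ u) → ∃[ s ] ∃[ u ] Member u × NonZeroVec u × A ▹ u ≋ s ⊙ u
      choose (yes found) = s , found
      choose (no ¬found) = ⊥-elim (supremum-eigenvalue W A A-sym A-inv s s-upper s-least none)
        where
        none : ∀ {x} → Member x → A ▹ x ≋ s ⊙ x → x ≋ 𝟎
        none {x} x∈W Ax with zeroVec? x
        ... | yes x≋0 = x≋0
        ... | no  x≉0 = ⊥-elim (¬found (x , x∈W , x≉0 , Ax))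

  eigenspace : ∀ {n} → Subspace n → Matrix n → Carrier → Subspace n
  eigenspace W A μ = record
    { Member      = λ x → Member x × A ▹ x ≋ μ ⊙ x
    ; ⊕-closed    = λ {x} {y} (x∈W , Ax) (y∈W , Ay) → ⊕-closed x∈W y∈W , λ i →
                 trans (▹-⊕ A x y i) (trans (+-cong (Ax i) (Ay i)) (sym (distribˡ μ (x i) (y i))))
    ; ⊙-closed    = λ a {x} (x∈W , Ax) → ⊙-closed a x∈W , λ i →
                 trans (▹-⊙ A a x i) (trans (*-congˡ (Ax i)) (x∙yz≈y∙xz a μ (x i)))
    ; Member-resp = λ x≋y (x∈W , Ax) → Member-resp x≋y x∈W , λ i →
                 trans (▹-cong A (λ j → sym (x≋y j)) i) (trans (Ax i) (*-congˡ (x≋y i)))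
    }
    where open Subspace W

  -- Induction on the number of matrices, with `W` varying: the eigenspace of the first matrix
  -- inside `W` is preserved by the others because they commute with it.
  commonEigenvector : ∀ {m n} (W : Subspace n) (A : Fin m → Matrix n) → let open Subspace W in
    (∀ p → Symmetric (A p)) → (∀ p q x → A p ▹ A q ▹ x ≋ A q ▹ A p ▹ x) →
    (∀ p {x} → Member x → Member (A p ▹ x)) → (∃[ x ] Member x × NonZeroVec x) →
    Σ[ μ ∈ Vec m ] ∃[ u ] Member u × NonZeroVec u × (∀ p → A p ▹ u ≋ μ p ⊙ u)
  commonEigenvector {zero} W A sy co iv (x , x∈W , x≉0) = (λ ()) , x , x∈W , x≉0 , λ ()
  commonEigenvector {suc m} {n} W A A-sym A-comm A-inv nontrivial =
    extend (eigenvector W (A zero) (A-sym zero) (A-inv zero) nontrivial)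
    where
    open Subspace W
    extend : (∃[ μ₀ ] ∃[ x ] Member x × NonZeroVec x × A zero ▹ x ≋ μ₀ ⊙ x) →
      Σ[ μ ∈ Vec (suc m) ] ∃[ u ] Member u × NonZeroVec u × (∀ p → A p ▹ u ≋ μ p ⊙ u)
    extend (μ₀ , x₀ , x₀∈W , x₀≉0 , eq₀) = merge (commonEigenvector (eigenspace W (A zero) μ₀) (A ∘ suc)
      (A-sym ∘ suc) (λ p q → A-comm (suc p) (suc q)) preserved (x₀ , (x₀∈W , eq₀) , x₀≉0))
      where
      preserved : ∀ p {x} → Member x × A zero ▹ x ≋ μ₀ ⊙ x → Member (A (suc p) ▹ x) × A zero ▹ A (suc p) ▹ x ≋ μ₀ ⊙ (A (suc p) ▹ x)
      preserved p {x} (x∈W , eq) = A-inv (suc p) x∈W , λ i →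
        trans (A-comm zero (suc p) x i) (trans (▹-cong (A (suc p)) eq i) (▹-⊙ (A (suc p)) μ₀ x i))
      merge : (Σ[ μ ∈ Vec m ] ∃[ u ] (Member u × A zero ▹ u ≋ μ₀ ⊙ u) × NonZeroVec u × (∀ p → A (suc p) ▹ u ≋ μ p ⊙ u)) →
        Σ[ μ ∈ Vec (suc m) ] ∃[ u ] Member u × NonZeroVec u × (∀ p → A p ▹ u ≋ μ p ⊙ u)
      merge (μ , u , (u∈W , eq) , u≉0 , eqs) =
        (λ { zero → μ₀ ; (suc p) → μ p }) , u , u∈W , u≉0 , λ { zero → eq ; (suc p) → eqs p }

  -- Splitting off a rank-one component

  -- Condition (i) for products of slices that contract the last index, expressed through inner
  -- products.
  LastSymmetric : ∀ {n} → Tensor n → Set ℓ₁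
  LastSymmetric T = ∀ i j i′ j′ → ⟨ T i j , T i′ j′ ⟩ ≈ ⟨ T i j′ , T i′ j ⟩

  swapYZ swapXZ : ∀ {n} → Tensor n → Tensor n
  swapYZ T i k j = T i j k
  swapXZ T k j i = T i j k

  -- The six symmetry requirements of condition (i) fall into three pairs, one for each contracted
  -- index; the two members of a pair agree up to commutativity of multiplication.
  SymmetricContractions : ∀ {n} → Tensor n → Set ℓ₁
  SymmetricContractions T = LastSymmetric T × LastSymmetric (swapYZ T) × LastSymmetric (swapXZ T)

  zeroOrEntry : ∀ {n} (T : Tensor n) → (∀ i j k → T i j k ≈ 0#) ⊎ (∃[ i ] ∃[ j ] ∃[ k ] ¬ T i j k ≈ 0#)
  zeroOrEntry T with decide (Lift c (∃[ i ] ∃[ j ] ∃[ k ] ¬ T i j k ≈ 0#))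
  ... | yes (lift T≉0) = inj₂ T≉0
  ... | no ¬T≉0 = inj₁ zeroEntry
    where
    zeroEntry : ∀ i j k → T i j k ≈ 0#
    zeroEntry i j k with ≈0? (T i j k)
    ... | yes T≈0 = T≈0
    ... | no  T≉0 = contradiction (lift (i , j , k , T≉0)) ¬T≉0

  -- The orthogonality relations are what lets condition (i) and the rank bound pass to the
  -- remainder `T′`.
  record Component {n} (T T′ : Tensor n) : Set (c ⊔ ℓ₁) where
    field
      u v w  : Vec n
      u≉0    : NonZeroVec u
      v≉0    : NonZeroVec v
      w≉0    : NonZeroVec w
      split  : ∀ i j k → T i j k ≈ u i * v j * w k + T′ i j k
      T′u≈0  : ∀ j k → ⟨ (λ i → T′ i j k) , u ⟩ ≈ 0#
      T′v≈0  : ∀ i k → ⟨ (λ j → T′ i j k) , v ⟩ ≈ 0#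
      T′w≈0  : ∀ i j → ⟨ T′ i j , w ⟩ ≈ 0#

  module _ {n} (S : Tensor n) (S-sym : SymmetricContractions S) where

    private
      S-sym-z = proj₁ S-sym
      S-sym-y = proj₁ (proj₂ S-sym)
      S-sym-x = proj₂ (proj₂ S-sym)

      Z Zᵗ : Fin n → Matrix n
      Z  k i j = S i j k
      Zᵗ k j i = S i j k

      ZZᵗ : Fin n → Fin n → Matrix n
      ZZᵗ k l i i′ = ⟨ Z k i , Z l i′ ⟩

      ZZᵗ▹ : ∀ k l x → ZZᵗ k l ▹ x ≋ Z k ▹ Zᵗ l ▹ x
      ZZᵗ▹ k l x i = ⟨⟩-combineˡ x (Z k i) (Zᵗ l)

      ZZᵗ-symmetric : ∀ k l → Symmetric (ZZᵗ k l)
      ZZᵗ-symmetric k l i i′ = trans (S-sym-y i k i′ l) (⟨⟩-comm _ _)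

      -- Since the transpose of `ZZᵗ k l` is `ZZᵗ l k`, symmetry of the product means that its two
      -- slice indices may be exchanged.
      ZZᵗ-swap : ∀ k l x → Z k ▹ Zᵗ l ▹ x ≋ Z l ▹ Zᵗ k ▹ x
      ZZᵗ-swap k l x i = begin
        (Z k ▹ Zᵗ l ▹ x) i   ≈⟨ ZZᵗ▹ k l x i ⟨
        (ZZᵗ k l ▹ x) i      ≈⟨ ⟨⟩-cong (λ i′ → S-sym-y i k i′ l) (λ _ → refl) ⟩
        (ZZᵗ l k ▹ x) i      ≈⟨ ZZᵗ▹ l k x i ⟩
        (Z l ▹ Zᵗ k ▹ x) i   ∎

      ZᵗZ-swap : ∀ k l y → Zᵗ k ▹ Z l ▹ y ≋ Zᵗ l ▹ Z k ▹ y
      ZᵗZ-swap k l y j = begin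
        (Zᵗ k ▹ Z l ▹ y) j   ≈⟨ ⟨⟩-combineˡ y (Zᵗ k j) (Z l) ⟨
        ⟨ (λ j′ → ⟨ Zᵗ k j , Zᵗ l j′ ⟩) , y ⟩   ≈⟨ ⟨⟩-cong (λ j′ → trans (S-sym-x k j l j′) (⟨⟩-comm _ _)) (λ _ → refl) ⟩
        ⟨ (λ j′ → ⟨ Zᵗ l j , Zᵗ k j′ ⟩) , y ⟩   ≈⟨ ⟨⟩-combineˡ y (Zᵗ l j) (Z k) ⟩
        (Zᵗ l ▹ Z k ▹ y) j   ∎

      -- The swaps exchange neighbouring indices in an alternating product of four slices; four of
      -- them carry k, l, k′, l′ to k′, l′, k, l.
      ZZᵗ-commute : ∀ k l k′ l′ x → ZZᵗ k l ▹ ZZᵗ k′ l′ ▹ x ≋ ZZᵗ k′ l′ ▹ ZZᵗ k l ▹ x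
      ZZᵗ-commute k l k′ l′ x i = begin
        (ZZᵗ k l ▹ ZZᵗ k′ l′ ▹ x) i               ≈⟨ unfold k l k′ l′ ⟩
        (Z k ▹ Zᵗ l ▹ Z k′ ▹ Zᵗ l′ ▹ x) i         ≈⟨ ▹-cong (Z k) (ZᵗZ-swap l k′ _) i ⟩
        (Z k ▹ Zᵗ k′ ▹ Z l ▹ Zᵗ l′ ▹ x) i         ≈⟨ ZZᵗ-swap k k′ _ i ⟩
        (Z k′ ▹ Zᵗ k ▹ Z l ▹ Zᵗ l′ ▹ x) i         ≈⟨ ▹-cong (Z k′) (▹-cong (Zᵗ k) (ZZᵗ-swap l l′ x)) i ⟩
        (Z k′ ▹ Zᵗ k ▹ Z l′ ▹ Zᵗ l ▹ x) i         ≈⟨ ▹-cong (Z k′) (ZᵗZ-swap k l′ _) i ⟩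
        (Z k′ ▹ Zᵗ l′ ▹ Z k ▹ Zᵗ l ▹ x) i         ≈⟨ unfold k′ l′ k l ⟨
        (ZZᵗ k′ l′ ▹ ZZᵗ k l ▹ x) i               ∎
        where
        unfold : ∀ k l k′ l′ → (ZZᵗ k l ▹ ZZᵗ k′ l′ ▹ x) i ≈ (Z k ▹ Zᵗ l ▹ Z k′ ▹ Zᵗ l′ ▹ x) i
        unfold k l k′ l′ = trans (▹-cong (ZZᵗ k l) (ZZᵗ▹ k′ l′ x) i) (ZZᵗ▹ k l _ i)

      Annihilated : Vec n → Set ℓ₁
      Annihilated y = ∀ j k → ⟨ Zᵗ k j , y ⟩ ≈ 0#

      -- The orthogonal complement of the kernel of x ↦ S(x, ·, ·). A nonzero vector in it cannot
      -- lie in that kernel, as it would be orthogonal to itself.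
      support : Subspace n
      support = record
        { Member      = λ x → ∀ y → Annihilated y → ⟨ x , y ⟩ ≈ 0#
        ; ⊕-closed    = λ {x} {x′} x⊥ x′⊥ y ann → trans (⟨⟩-⊕ˡ x x′ y) (trans (+-cong (x⊥ y ann) (x′⊥ y ann)) (+-identityʳ 0#))
        ; ⊙-closed    = λ a {x} x⊥ y ann → trans (⟨⟩-⊙ˡ a x y) (trans (*-congˡ (x⊥ y ann)) (zeroʳ a))
        ; Member-resp = λ x≋x′ x⊥ y ann → trans (⟨⟩-cong (λ i → sym (x≋x′ i)) (λ _ → refl)) (x⊥ y ann)
        }

      open Subspace support

      support-invariant : ∀ k l {x} → Member x → Member (ZZᵗ k l ▹ x)
      support-invariant k l {x} x⊥ y ann = begin
        ⟨ ZZᵗ k l ▹ x , y ⟩        ≈⟨ ⟨,▹⟩-symmetric (ZZᵗ k l) (ZZᵗ-symmetric k l) x y ⟨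
        ⟨ x , ZZᵗ k l ▹ y ⟩        ≈⟨ ⟨⟩-zeroʳ x (λ i → trans (ZZᵗ▹ k l y i) (⟨⟩-zeroʳ (Z k i) (λ j → ann j l))) ⟩
        0#                         ∎

    -- With σ the inverse of `⟨ v , v ⟩`, the three equations say that `S` and σ u ⊗ v ⊗ w have the
    -- same contractions with `u`, with `v` and with `w`. They are cleared of denominators.
    EigenTriple : Set (c ⊔ ℓ₁)
    EigenTriple = ∃[ u ] ∃[ v ] ∃[ w ] NonZeroVec u × NonZeroVec v × NonZeroVec w ×
      (∀ j k → ⟨ v , v ⟩ * ⟨ (λ i → S i j k) , u ⟩ ≈ ⟨ u , u ⟩ * (v j * w k)) ×
      (∀ i k → ⟨ (λ j → S i j k) , v ⟩ ≈ w k * u i) ×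
      (∀ i j → ⟨ v , v ⟩ * ⟨ S i j , w ⟩ ≈ u i * v j * ⟨ w , w ⟩)

    -- For a joint eigenvector u of the matrices Z k (Z l)ᵀ, the slice B j k = S(u, j, k) has rank one:
    -- it is a multiple of v ⊗ w for v = B(·, l) and w the eigenvalues of the Z k (Z l)ᵀ with l fixed.
    eigenTriple-from : ∀ (λ₀ : Fin n → Fin n → Carrier) u → Member u → NonZeroVec u →
      (∀ k l → ZZᵗ k l ▹ u ≋ λ₀ k l ⊙ u) → EigenTriple
    eigenTriple-from λ₀ u u∈W u≉0 eigen = fromEntry B-nonZero
      where
      B : Fin n → Fin n → Carrier
      B j k = ⟨ Zᵗ k j , u ⟩

      B-nonZero : ∃[ j ] ∃[ l ] ¬ B j l ≈ 0#
      B-nonZero with decide (Lift c (∃[ j ] ∃[ l ] ¬ B j l ≈ 0#))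
      ... | yes (lift B≉0) = B≉0
      ... | no ¬B≉0 = contradiction (⟨x,x⟩≈0⇒x≋0 u (u∈W u annihilated)) u≉0
        where
        annihilated : Annihilated u
        annihilated j l with ≈0? (B j l)
        ... | yes B≈0 = B≈0
        ... | no  B≉0 = contradiction (lift (j , l , B≉0)) ¬B≉0

      SB : ∀ k l i → ⟨ Z k i , (λ j → B j l) ⟩ ≈ λ₀ k l * u i
      SB k l i = trans (sym (ZZᵗ▹ k l u i)) (eigen k l i)

      fromEntry : ∃[ j ] ∃[ l ] ¬ B j l ≈ 0# → EigenTriple
      fromEntry (j₀ , l , B≉0) = u , v , w , u≉0 , v≉0 , w≉0 , contract-u , (λ i k → SB k l i) , contract-w
        where
        v w : Vec n
        v j = B j l
        w k = λ₀ k l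
        v≉0 : NonZeroVec v
        v≉0 v≋0 = B≉0 (v≋0 j₀)
        -- This identity makes the eigenvalue `w l` nonzero, hence `w` nonzero and `w l`
        -- cancellable.
        ⟨v,v⟩ : ⟨ v , v ⟩ ≈ w l * ⟨ u , u ⟩
        ⟨v,v⟩ = begin
          ⟨ Zᵗ l ▹ u , v ⟩     ≈⟨ ⟨▹,⟩ (Zᵗ l) u v ⟩
          ⟨ u , Z l ▹ v ⟩      ≈⟨ ⟨⟩-cong (λ _ → refl) (SB l l) ⟩
          ⟨ u , w l ⊙ u ⟩      ≈⟨ ⟨⟩-⊙ʳ (w l) u u ⟩
          w l * ⟨ u , u ⟩      ∎
        wl≉0 : ¬ w l ≈ 0#
        wl≉0 wl≈0 = ⟨x,x⟩≉0 v v≉0 (trans ⟨v,v⟩ (trans (*-congʳ wl≈0) (zeroˡ _)))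
        w≉0 : NonZeroVec w
        w≉0 w≋0 = wl≉0 (w≋0 l)
        -- By `S-sym-x` the left side is symmetric in `k` and `k′`. Comparing the two right sides
        -- for `k′` equal to `l` shows that `B` is proportional to v ⊗ w.
        exchange : ∀ j k k′ → ⟨ v , (λ j′ → ⟨ Zᵗ k j′ , Zᵗ k′ j ⟩) ⟩ ≈ w k * B j k′
        exchange j k k′ = begin
          ⟨ v , (λ j′ → ⟨ Zᵗ k j′ , Zᵗ k′ j ⟩) ⟩   ≈⟨ ⟨⟩-comm _ _ ⟩
          ⟨ Zᵗ k ▹ Zᵗ k′ j , v ⟩                    ≈⟨ ⟨▹,⟩ (Zᵗ k) (Zᵗ k′ j) v ⟩
          ⟨ Zᵗ k′ j , Z k ▹ v ⟩                     ≈⟨ ⟨⟩-cong (λ _ → refl) (SB k l) ⟩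
          ⟨ Zᵗ k′ j , w k ⊙ u ⟩                     ≈⟨ ⟨⟩-⊙ʳ (w k) (Zᵗ k′ j) u ⟩
          w k * B j k′                              ∎
        B-rankOne : ∀ j k → w l * B j k ≈ w k * v j
        B-rankOne j k = begin
          w l * B j k                               ≈⟨ exchange j l k ⟨
          ⟨ v , (λ j′ → ⟨ Zᵗ l j′ , Zᵗ k j ⟩) ⟩     ≈⟨ ⟨⟩-cong (λ _ → refl) (λ j′ → trans (S-sym-x l j′ k j) (⟨⟩-comm _ _)) ⟩
          ⟨ v , (λ j′ → ⟨ Zᵗ k j′ , Zᵗ l j ⟩) ⟩     ≈⟨ exchange j k l ⟩
          w k * v j                                 ∎
        contract-u : ∀ j k → ⟨ v , v ⟩ * B j k ≈ ⟨ u , u ⟩ * (v j * w k)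
        contract-u j k = begin
          ⟨ v , v ⟩ * B j k              ≈⟨ *-congʳ ⟨v,v⟩ ⟩
          w l * ⟨ u , u ⟩ * B j k        ≈⟨ trans (*-congʳ (*-comm _ _)) (*-assoc _ _ _) ⟩
          ⟨ u , u ⟩ * (w l * B j k)      ≈⟨ *-congˡ (trans (B-rankOne j k) (*-comm _ _)) ⟩
          ⟨ u , u ⟩ * (v j * w k)        ∎
        SB-w : ∀ i j j′ → w l * ⟨ S i j , B j′ ⟩ ≈ v j′ * ⟨ S i j , w ⟩
        SB-w i j j′ = begin
          w l * ⟨ S i j , B j′ ⟩         ≈⟨ ⟨⟩-⊙ʳ (w l) (S i j) (B j′) ⟨
          ⟨ S i j , w l ⊙ B j′ ⟩         ≈⟨ ⟨⟩-cong (λ _ → refl) (λ k → trans (B-rankOne j′ k) (*-comm _ _)) ⟩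
          ⟨ S i j , v j′ ⊙ w ⟩           ≈⟨ ⟨⟩-⊙ʳ (v j′) (S i j) w ⟩
          v j′ * ⟨ S i j , w ⟩           ∎
        SB-swap : ∀ i j j′ → ⟨ S i j , B j′ ⟩ ≈ ⟨ S i j′ , B j ⟩
        SB-swap i j j′ = begin
          ⟨ S i j , B j′ ⟩                           ≈⟨ ⟨▹,⟩-B i j j′ ⟩
          ⟨ (λ i′ → ⟨ S i j , S i′ j′ ⟩) , u ⟩       ≈⟨ ⟨⟩-cong (λ i′ → S-sym-z i j i′ j′) (λ _ → refl) ⟩
          ⟨ (λ i′ → ⟨ S i j′ , S i′ j ⟩) , u ⟩       ≈⟨ ⟨▹,⟩-B i j′ j ⟨
          ⟨ S i j′ , B j ⟩                           ∎
          where
          ⟨▹,⟩-B : ∀ i j j′ → ⟨ S i j , B j′ ⟩ ≈ ⟨ (λ i′ → ⟨ S i j , S i′ j′ ⟩) , u ⟩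
          ⟨▹,⟩-B i j j′ = sym (⟨⟩-combineˡ u (S i j) (λ k → Zᵗ k j′))
        exchange-w : ∀ i j j′ → v j′ * ⟨ S i j , w ⟩ ≈ v j * ⟨ S i j′ , w ⟩
        exchange-w i j j′ = trans (sym (SB-w i j j′)) (trans (*-congˡ (SB-swap i j j′)) (SB-w i j′ j))
        contract-w : ∀ i j → ⟨ v , v ⟩ * ⟨ S i j , w ⟩ ≈ u i * v j * ⟨ w , w ⟩
        contract-w i j = begin
          ⟨ v , v ⟩ * ⟨ S i j , w ⟩                       ≈⟨ ∑-* _ _ ⟩
          -- `exchange-w` trades one factor `v j′` for `v j`; what remains is the contraction of
          -- `S i` with both `v` and `w`, which `SB` evaluates.
          ∑ (λ j′ → v j′ * v j′ * ⟨ S i j , w ⟩)          ≈⟨ ∑-cong (λ j′ → trans (*-assoc _ _ _) (trans (*-congˡ (exchange-w i j j′)) (x∙yz≈y∙xz _ _ _))) ⟩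
          ∑ (λ j′ → v j * (v j′ * ⟨ S i j′ , w ⟩))        ≈⟨ *-∑ (v j) _ ⟨
          v j * ⟨ v , S i ▹ w ⟩                           ≈⟨ *-congˡ (trans (⟨⟩-comm _ _) (⟨▹,⟩ (S i) w v)) ⟩
          v j * ⟨ w , (λ k → ⟨ Z k i , v ⟩) ⟩             ≈⟨ *-congˡ (⟨⟩-cong (λ _ → refl) (λ k → trans (SB k l i) (*-comm _ _))) ⟩
          v j * ⟨ w , u i ⊙ w ⟩                           ≈⟨ *-congˡ (⟨⟩-⊙ʳ (u i) w w) ⟩
          v j * (u i * ⟨ w , w ⟩)                         ≈⟨ trans (x∙yz≈y∙xz _ _ _) (sym (*-assoc _ _ _)) ⟩
          u i * v j * ⟨ w , w ⟩                           ∎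

    eigenTriple : ∃[ i ] ∃[ j ] ∃[ k ] ¬ S i j k ≈ 0# → EigenTriple
    eigenTriple (i₀ , j₀ , k₀ , S≉0) = fromCommon (commonEigenvector support
      (λ p → A (remQuot {n} n p))
      (λ p → ZZᵗ-symmetric _ _) (λ p q → ZZᵗ-commute _ _ _ _) (λ p → support-invariant _ _)
      -- The fibre through a nonzero entry is nonzero, and annihilated vectors are orthogonal to it
      -- by definition.
      ((λ i → S i j₀ k₀) , (λ y ann → ann j₀ k₀) , λ h → S≉0 (h i₀)))
      where
      A : Fin n × Fin n → Matrix n
      A (k , l) = ZZᵗ k l
      fromCommon : (Σ[ μ ∈ Vec (n ℕ.* n) ] ∃[ u ] Member u × NonZeroVec u × (∀ p → A (remQuot {n} n p) ▹ u ≋ μ p ⊙ u)) → EigenTriple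
      fromCommon (μ , u , u∈W , u≉0 , eigen) = eigenTriple-from (λ k l → μ (combine k l)) u u∈W u≉0
        λ k l → ≡.subst (λ kl → A kl ▹ u ≋ μ (combine k l) ⊙ u) (remQuot-combine {n} {n} k l) (eigen (combine k l))

    -- Subtracting σ u ⊗ v ⊗ w removes all three contractions of `EigenTriple`; σ is absorbed into
    -- the first vector. The vanishing is checked after multiplication by `q`, which cancels.
    component : ∃[ i ] ∃[ j ] ∃[ k ] ¬ S i j k ≈ 0# → ∃[ S′ ] Component S S′
    component S≉0 = fromTriple (eigenTriple S≉0)
      where
      fromTriple : EigenTriple → ∃[ S′ ] Component S S′
      fromTriple (u , v , w , u≉0 , v≉0 , w≉0 , Su , Sv , Sw) = normalise (invertible q (⟨x,x⟩≉0 v v≉0))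
        where
        q = ⟨ v , v ⟩
        normalise : ∃[ σ ] q * σ ≈ 1# → ∃[ S′ ] Component S S′
        normalise (σ , qσ≈1) = S′ , record
          { u = σ ⊙ u ; v = v ; w = w
          ; u≉0 = λ h → u≉0 λ i → x*y≈0⇒y≈0 σ≉0 (h i) ; v≉0 = v≉0 ; w≉0 = w≉0
          ; split = λ i j k → split (S i j k) (σ * u i * v j * w k)
          ; T′u≈0 = λ j k → trans (⟨⟩-⊙ʳ σ _ u) (trans (*-congˡ (q-cancel (S′u j k))) (zeroʳ σ))
          ; T′v≈0 = λ i k → S′v i k
          ; T′w≈0 = λ i j → q-cancel (S′w i j)
          }
          where
          S′ : Tensor n
          S′ i j k = S i j k + - (σ * u i * v j * w k)
          split : ∀ x y → x ≈ y + (x + - y)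
          split = solve 2 (λ x y → x := y :+ (x :+ :- y)) refl
          q≉0 : ¬ q ≈ 0#
          q≉0 = ⟨x,x⟩≉0 v v≉0
          q-cancel : ∀ {x} → q * x ≈ 0# → x ≈ 0#
          q-cancel = x*y≈0⇒y≈0 q≉0
          σ≉0 : ¬ σ ≈ 0#
          σ≉0 σ≈0 = 1≉0 (trans (sym qσ≈1) (trans (*-congˡ σ≈0) (zeroʳ q)))
          σ-cancel : ∀ x → q * (- σ * x) ≈ - x
          σ-cancel x = trans (pull q σ x) (-‿cong (trans (*-congʳ qσ≈1) (*-identityˡ x)))
            where
            pull : ∀ q σ x → q * (- σ * x) ≈ - (q * σ * x)
            pull = solve 3 (λ q σ x → q :* ((:- σ) :* x) := :- (q :* σ :* x)) refl
          contract : ∀ (x t z : Vec n) a → ⟨ (λ i → x i + - σ * (a * t i)) , z ⟩ ≈ ⟨ x , z ⟩ + - σ * (a * ⟨ t , z ⟩)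
          contract x t z a = trans (⟨⟩-⊕ˡ x _ z) (+-congˡ (trans (⟨⟩-⊙ˡ (- σ) (a ⊙ t) z) (*-congˡ (⟨⟩-⊙ˡ a t z))))
          cancelled : ∀ x y → q * x ≈ y → q * (x + - σ * y) ≈ 0#
          cancelled x y qx≈y = trans (distribˡ q x _) (trans (+-cong qx≈y (σ-cancel y)) (-‿inverseʳ y))
          S′u : ∀ j k → q * ⟨ (λ i → S′ i j k) , u ⟩ ≈ 0#
          S′u j k = trans (*-congˡ (trans (⟨⟩-cong (λ i → +-congˡ (rearrange σ (u i) (v j) (w k))) (λ _ → refl)) (contract _ u u (v j * w k))))
            (cancelled _ _ (trans (Su j k) (*-comm _ _)))
            where
            rearrange : ∀ σ u v w → - (σ * u * v * w) ≈ - σ * (v * w * u)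
            rearrange = solve 4 (λ σ u v w → :- (σ :* u :* v :* w) := (:- σ) :* (v :* w :* u)) refl
          S′w : ∀ i j → q * ⟨ S′ i j , w ⟩ ≈ 0#
          S′w i j = trans (*-congˡ (trans (⟨⟩-cong (λ k → +-congˡ (rearrange σ (u i) (v j) (w k))) (λ _ → refl)) (contract _ w w (u i * v j))))
            (cancelled _ _ (Sw i j))
            where
            rearrange : ∀ σ u v w → - (σ * u * v * w) ≈ - σ * (u * v * w)
            rearrange = solve 4 (λ σ u v w → :- (σ :* u :* v :* w) := (:- σ) :* (u :* v :* w)) refl
          S′v : ∀ i k → ⟨ (λ j → S′ i j k) , v ⟩ ≈ 0#
          S′v i k = q-cancel (trans (*-congˡ (trans (⟨⟩-cong (λ j → +-congˡ (rearrange σ (u i) (v j) (w k))) (λ _ → refl)) (contract _ v v (w k * u i))))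
            (cancelled _ _ (trans (*-congˡ (Sv i k)) (*-comm _ _))))
            where
            rearrange : ∀ σ u v w → - (σ * u * v * w) ≈ - σ * (w * u * v)
            rearrange = solve 4 (λ σ u v w → :- (σ :* u :* v :* w) := (:- σ) :* (w :* u :* v)) refl

  -- Inheritance of the hypotheses by the remainder

  -- The cross terms vanish because `w` is orthogonal to the fibres of `T′`, so the inner products
  -- of `T` are those of `T′` plus a part with the required symmetry. A general matrix `a` lets one
  -- proof serve all three directions.
  lastSymmetric-deflate : ∀ {n} {T T′ : Tensor n} (a : Matrix n) (w : Vec n) →
    (∀ i j k → T i j k ≈ a i j * w k + T′ i j k) → (∀ i j → ⟨ T′ i j , w ⟩ ≈ 0#) →
    (∀ i j i′ j′ → a i j * a i′ j′ ≈ a i j′ * a i′ j) →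
    LastSymmetric T → LastSymmetric T′
  lastSymmetric-deflate {n} {T} {T′} a w T≈ T′w≈0 a-swap T-sym i j i′ j′ = +-cancelˡ (a i j * a i′ j′ * ⟨ w , w ⟩) _ _ (begin
    a i j * a i′ j′ * ⟨ w , w ⟩ + ⟨ T′ i j , T′ i′ j′ ⟩     ≈⟨ expand i j i′ j′ ⟨
    ⟨ T i j , T i′ j′ ⟩                                     ≈⟨ T-sym i j i′ j′ ⟩
    ⟨ T i j′ , T i′ j ⟩                                     ≈⟨ expand i j′ i′ j ⟩
    a i j′ * a i′ j * ⟨ w , w ⟩ + ⟨ T′ i j′ , T′ i′ j ⟩     ≈⟨ +-congʳ (*-congʳ (a-swap i j i′ j′)) ⟨
    a i j * a i′ j′ * ⟨ w , w ⟩ + ⟨ T′ i j′ , T′ i′ j ⟩     ∎)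
    where
    expand : ∀ i j i′ j′ → ⟨ T i j , T i′ j′ ⟩ ≈ a i j * a i′ j′ * ⟨ w , w ⟩ + ⟨ T′ i j , T′ i′ j′ ⟩
    expand i j i′ j′ = begin
      ⟨ T i j , T i′ j′ ⟩
        ≈⟨ ⟨⟩-cong (T≈ i j) (T≈ i′ j′) ⟩
      ⟨ a i j ⊙ w ⊕ T′ i j , a i′ j′ ⊙ w ⊕ T′ i′ j′ ⟩
        ≈⟨ ⟨⟩-⊕ˡ (a i j ⊙ w) (T′ i j) _ ⟩
      ⟨ a i j ⊙ w , a i′ j′ ⊙ w ⊕ T′ i′ j′ ⟩ + ⟨ T′ i j , a i′ j′ ⊙ w ⊕ T′ i′ j′ ⟩
        ≈⟨ +-cong (trans (⟨⟩-⊙ˡ (a i j) w _) (*-congˡ (trans (⟨⟩-⊕ʳ w _ _) (+-cong (⟨⟩-⊙ʳ _ w w) (trans (⟨⟩-comm _ _) (T′w≈0 i′ j′))))))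
                  (trans (⟨⟩-⊕ʳ (T′ i j) _ _) (+-congʳ (trans (⟨⟩-⊙ʳ _ _ w) (trans (*-congˡ (T′w≈0 i j)) (zeroʳ _))))) ⟩
      a i j * (a i′ j′ * ⟨ w , w ⟩ + 0#) + (0# + ⟨ T′ i j , T′ i′ j′ ⟩)
        ≈⟨ +-cong (trans (*-congˡ (+-identityʳ _)) (sym (*-assoc _ _ _))) (+-identityˡ _) ⟩
      a i j * a i′ j′ * ⟨ w , w ⟩ + ⟨ T′ i j , T′ i′ j′ ⟩
        ∎

  symmetricContractions-deflate : ∀ {n} {T T′ : Tensor n} → Component T T′ → SymmetricContractions T → SymmetricContractions T′
  symmetricContractions-deflate {T = T} {T′} C (sz , sy , sx) =
    lastSymmetric-deflate (λ i j → u i * v j) w split T′w≈0 (λ i j i′ j′ → swap _ _ _ _) sz ,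
    lastSymmetric-deflate {T = swapYZ T} {swapYZ T′} (λ i k → u i * w k) v
      (λ i k j → trans (split i j k) (+-congʳ (trans (*-assoc _ _ _) (trans (*-congˡ (*-comm _ _)) (sym (*-assoc _ _ _))))))
      (λ i k → T′v≈0 i k) (λ i j i′ j′ → swap _ _ _ _) sy ,
    lastSymmetric-deflate {T = swapXZ T} {swapXZ T′} (λ k j → w k * v j) u
      (λ k j i → trans (split i j k) (+-congʳ (trans (*-comm _ _) (trans (*-congˡ (*-comm _ _)) (sym (*-assoc _ _ _))))))
      (λ k j → T′u≈0 j k) (λ i j i′ j′ → swap _ _ _ _) sx
    where
    open Component C
    swap : ∀ a b c d → a * b * (c * d) ≈ a * d * (c * b)
    swap = solve 4 (λ a b c d → a :* b :* (c :* d) := a :* d :* (c :* b)) refl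

  Dependent : ∀ {s n} → (Fin s → Vec n) → Set (c ⊔ ℓ₁)
  Dependent {s} x = Σ[ b ∈ Vec s ] NonZeroVec b × (∀ i → ∑ (λ p → b p * x p i) ≈ 0#)

  contraction : ∀ {n} → Tensor n → Vec n → Matrix n
  contraction T a i j = ⟨ T i j , a ⟩

  -- Rank at most `r` throughout the span of the z-slices, phrased by images of arbitrary vectors
  -- instead of columns, so that `rankBound-deflate` may adjoin `v` to the family.
  RankBound : ∀ {n} → ℕ → Tensor n → Set (c ⊔ ℓ₁)
  RankBound {n} r T = ∀ a (Y : Fin (suc r) → Vec n) → Dependent (λ p → contraction T a ▹ Y p)

  -- Shift a by a multiple of w so that ⟨ w , a ⟩ = 1; then the contraction of T is u ⊗ v plus that of T′.
  rankBound-deflate : ∀ {n r} {T T′ : Tensor n} → Component T T′ → RankBound (suc r) T → RankBound r T′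
  rankBound-deflate {n} {r} {T} {T′} C T-bound a Y = fromInverse (invertible ⟨ w , w ⟩ (⟨x,x⟩≉0 w w≉0))
    where
    open Component C

    fromInverse : ∃[ σ ] ⟨ w , w ⟩ * σ ≈ 1# → Dependent (λ p → contraction T′ a ▹ Y p)
    fromInverse (σ , inv) = fromDependent (T-bound a′ Y′)
      where
      τ = (1# - ⟨ w , a ⟩) * σ
      a′ : Vec n
      a′ = a ⊕ τ ⊙ w
      ⟨w,a′⟩ : ⟨ w , a′ ⟩ ≈ 1#
      ⟨w,a′⟩ = begin
        ⟨ w , a′ ⟩                                                 ≈⟨ trans (⟨⟩-⊕ʳ w a (τ ⊙ w)) (+-congˡ (⟨⟩-⊙ʳ τ w w)) ⟩
        ⟨ w , a ⟩ + (1# - ⟨ w , a ⟩) * σ * ⟨ w , w ⟩               ≈⟨ rearrange ⟨ w , a ⟩ σ ⟨ w , w ⟩ ⟩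
        ⟨ w , a ⟩ + (1# - ⟨ w , a ⟩) * (⟨ w , w ⟩ * σ)             ≈⟨ +-congˡ (trans (*-congˡ inv) (*-identityʳ _)) ⟩
        ⟨ w , a ⟩ + (1# - ⟨ w , a ⟩)                               ≈⟨ cancel ⟨ w , a ⟩ ⟩
        1#                                                         ∎
        where
        rearrange : ∀ x σ q → x + (1# - x) * σ * q ≈ x + (1# - x) * (q * σ)
        rearrange = solve 3 (λ x σ q → x :+ (con (+ 1) :- x) :* σ :* q := x :+ (con (+ 1) :- x) :* (q :* σ)) refl
        cancel : ∀ x → x + (1# - x) ≈ 1#
        cancel = solve 1 (λ x → x :+ (con (+ 1) :- x) := con (+ 1)) refl

      -- The extra vector `v` is sent by `M` to a multiple of `u`, whereas the image of `M′` is
      -- orthogonal to `u`.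
      Y′ : Fin (suc (suc r)) → Vec n
      Y′ zero    = v
      Y′ (suc p) = Y p

      M M′ : Matrix n
      M  = contraction T a′
      M′ = contraction T′ a

      M≈ : ∀ i j → M i j ≈ u i * v j + M′ i j
      M≈ i j = begin
        ⟨ T i j , a′ ⟩                                    ≈⟨ ⟨⟩-cong (split i j) (λ _ → refl) ⟩
        ⟨ (u i * v j) ⊙ w ⊕ T′ i j , a′ ⟩                 ≈⟨ ⟨⟩-⊕ˡ _ (T′ i j) a′ ⟩
        ⟨ (u i * v j) ⊙ w , a′ ⟩ + ⟨ T′ i j , a′ ⟩        ≈⟨ +-cong (trans (⟨⟩-⊙ˡ _ w a′) (trans (*-congˡ ⟨w,a′⟩) (*-identityʳ _)))
                                                               (trans (⟨⟩-⊕ʳ (T′ i j) a _) (trans (+-congˡ (trans (⟨⟩-⊙ʳ τ _ w) (trans (*-congˡ (T′w≈0 i j)) (zeroʳ τ)))) (+-identityʳ _))) ⟩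
        u i * v j + M′ i j                                ∎

      M▹ : ∀ y → M ▹ y ≋ ⟨ v , y ⟩ ⊙ u ⊕ M′ ▹ y
      M▹ y i = trans (⟨⟩-cong (M≈ i) (λ _ → refl)) (trans (⟨⟩-⊕ˡ (u i ⊙ v) (M′ i) y) (+-congʳ (trans (⟨⟩-⊙ˡ (u i) v y) (*-comm _ _))))

      M′v≋0 : M′ ▹ v ≋ 𝟎
      M′v≋0 i = begin
        ⟨ T′ i ▹ a , v ⟩                       ≈⟨ ⟨▹,⟩ (T′ i) a v ⟩
        ⟨ a , (λ k → ⟨ (λ j → T′ i j k) , v ⟩) ⟩  ≈⟨ ⟨⟩-zeroʳ a (λ k → T′v≈0 i k) ⟩
        0#                                     ∎

      ⟨u,M′y⟩ : ∀ y → ⟨ u , M′ ▹ y ⟩ ≈ 0#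
      ⟨u,M′y⟩ y = trans (⟨⟩-comm _ _) (trans (⟨▹,⟩ M′ y u) (⟨⟩-zeroʳ y λ j → begin
        ⟨ (λ i → ⟨ T′ i j , a ⟩) , u ⟩           ≈⟨ ⟨▹,⟩ (λ i → T′ i j) a u ⟩
        ⟨ a , (λ k → ⟨ (λ i → T′ i j k) , u ⟩) ⟩  ≈⟨ ⟨⟩-zeroʳ a (λ k → T′u≈0 j k) ⟩
        0#                                       ∎))

      fromDependent : Dependent (λ p → M ▹ Y′ p) → Dependent (λ p → M′ ▹ Y p)
      fromDependent (b , b≉0 , dep) = b′ , b′≉0 , λ i → begin
          z i                ≈⟨ +-identityˡ _ ⟨
          0# + z i           ≈⟨ +-congʳ (trans (*-congʳ κ≈0) (zeroˡ _)) ⟨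
          κ * u i + z i      ≈⟨ relation i ⟩
          0#                 ∎
        where
        b′ : Vec (suc r)
        b′ = b ∘ suc
        z : Vec n
        z i = ∑ λ p → b′ p * (M′ ▹ Y p) i
        β = ∑ λ p → b′ p * ⟨ v , Y p ⟩
        -- The total coefficient of `u` in the dependence relation; pairing the relation with `u`
        -- shows that it vanishes, leaving a relation among the `M′ ▹ Y p`.
        κ = b zero * ⟨ v , v ⟩ + β
        relation : ∀ i → κ * u i + z i ≈ 0#
        relation i = begin
          κ * u i + z i
            ≈⟨ regroup (b zero) ⟨ v , v ⟩ β (u i) (z i) ⟩
          b zero * (⟨ v , v ⟩ * u i + 0#) + (β * u i + z i)
            ≈⟨ +-cong (*-congˡ (trans (M▹ v i) (+-congˡ (M′v≋0 i)))) (trans (∑-cong λ p → trans (*-congˡ (M▹ (Y p) i)) (trans (distribˡ _ _ _) (+-congʳ (sym (*-assoc _ _ _)))))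
                 (trans (∑-+ _ _) (+-congʳ (sym (∑-* (u i) _))))) ⟨
          b zero * (M ▹ v) i + ∑ (λ p → b′ p * (M ▹ Y p) i)
            ≈⟨ ∑-suc _ ⟨
          ∑ (λ p → b p * (M ▹ Y′ p) i)
            ≈⟨ dep i ⟩
          0# ∎
          where
          regroup : ∀ b q β u z → (b * q + β) * u + z ≈ b * (q * u + 0#) + (β * u + z)
          regroup = solve 5 (λ b q β u z → (b :* q :+ β) :* u :+ z := b :* (q :* u :+ con (+ 0)) :+ (β :* u :+ z)) refl
        κ≈0 : κ ≈ 0#
        κ≈0 = x*y≈0⇒y≈0 (⟨x,x⟩≉0 u u≉0) (begin
          ⟨ u , u ⟩ * κ                        ≈⟨ trans (*-comm _ _) (sym (+-identityʳ _)) ⟩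
          κ * ⟨ u , u ⟩ + 0#                   ≈⟨ +-cong (⟨⟩-⊙ʳ κ u u) (trans (⟨⟩-combineʳ u b′ (λ p → M′ ▹ Y p)) (∑-≈0 λ p → trans (*-congˡ (⟨u,M′y⟩ (Y p))) (zeroʳ _))) ⟨
          ⟨ u , κ ⊙ u ⟩ + ⟨ u , z ⟩            ≈⟨ ⟨⟩-⊕ʳ u (κ ⊙ u) z ⟨
          ⟨ u , κ ⊙ u ⊕ z ⟩                    ≈⟨ ⟨⟩-zeroʳ u relation ⟩
          0#                                   ∎)
        b′≉0 : NonZeroVec b′
        b′≉0 b′≋0 = b≉0 λ { zero → b₀≈0 ; (suc p) → b′≋0 p }
          where
          b₀≈0 : b zero ≈ 0#
          b₀≈0 = x*y≈0⇒y≈0 (⟨x,x⟩≉0 v v≉0) (begin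
            ⟨ v , v ⟩ * b zero          ≈⟨ *-comm _ _ ⟩
            b zero * ⟨ v , v ⟩          ≈⟨ +-identityʳ _ ⟨
            b zero * ⟨ v , v ⟩ + 0#     ≈⟨ +-congˡ (∑-≈0 λ p → trans (*-congʳ (b′≋0 p)) (zeroˡ _)) ⟨
            κ                           ≈⟨ κ≈0 ⟩
            0#                          ∎)

  -- Decomposition into a prescribed number of terms

  -- Zero vectors are allowed here, unlike in `IsSumOfRankOnes`, so that a decomposition can be
  -- padded to any larger number of terms.
  record Decomposition {n} (T : Tensor n) (r : ℕ) : Set (c ⊔ ℓ₁) where
    constructor decomposition
    field
      {u v w} : Fin r → Vec n
      decomposes : ∀ i j k → T i j k ≈ ∑ (λ p → u p i * v p j * w p k)

  prepend : ∀ {n r} {T T′ : Tensor n} (u v w : Vec n) → (∀ i j k → T i j k ≈ u i * v j * w k + T′ i j k) →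
            Decomposition T′ r → Decomposition T (suc r)
  prepend {n} {r} u₀ v₀ w₀ split (decomposition {u} {v} {w} T′≈) =
    decomposition {u = u₀ ∷ u} {v₀ ∷ v} {w₀ ∷ w} λ i j k → trans (split i j k) (trans (+-congˡ (T′≈ i j k)) (sym (∑-suc _)))

  zeroDecomposition : ∀ {n} {T : Tensor n} r → (∀ i j k → T i j k ≈ 0#) → Decomposition T r
  zeroDecomposition r T≈0 = decomposition {u = λ _ → 𝟎} {λ _ → 𝟎} {λ _ → 𝟎} λ i j k →
    trans (T≈0 i j k) (sym (∑-≈0 λ p → zeroʳ _))

  -- A dependent family of one vector is zero; basis vectors for `a` and `Y` make its coordinates
  -- entries of `T`.
  rankBound-zero : ∀ {n} {T : Tensor n} → RankBound 0 T → ∀ i j k → T i j k ≈ 0#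
  rankBound-zero {T = T} T-bound i j k = fromDependent (T-bound (δ k) (λ _ → δ j))
    where
    Mδ = contraction T (δ k) ▹ δ j
    fromDependent : Dependent (λ (_ : Fin 1) → Mδ) → T i j k ≈ 0#
    fromDependent (b , b≉0 , dep) = trans (sym entry) (x*y≈0⇒y≈0 (λ b₀≈0 → b≉0 λ { zero → b₀≈0 })
      (trans (sym (+-identityʳ _)) (trans (+-congˡ (sym (∑-zero _))) (trans (sym (∑-suc _)) (dep i)))))
      where
      entry : Mδ i ≈ T i j k
      entry = begin
        ⟨ contraction T (δ k) i , δ j ⟩      ≈⟨ trans (⟨⟩-comm _ _) (δ▹ _ j) ⟩
        ⟨ T i j , δ k ⟩                      ≈⟨ trans (⟨⟩-comm _ _) (δ▹ _ k) ⟩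
        T i j k                              ∎

  -- Each component removed lowers the rank bound by one. If the tensor vanishes early, the
  -- remaining terms are zero.
  decompose : ∀ {n} r (S : Tensor n) → SymmetricContractions S → RankBound r S → Decomposition S r
  decompose zero S S-sym S-bound = zeroDecomposition 0 (rankBound-zero S-bound)
  decompose {n} (suc r) S S-sym S-bound = byCases (zeroOrEntry S)
    where
    fromComponent : ∃[ S′ ] Component S S′ → Decomposition S (suc r)
    fromComponent (S′ , C) = prepend u v w split
      (decompose r S′ (symmetricContractions-deflate C S-sym) (rankBound-deflate C S-bound))
      where open Component C
    byCases : (∀ i j k → S i j k ≈ 0#) ⊎ (∃[ i ] ∃[ j ] ∃[ k ] ¬ S i j k ≈ 0#) → Decomposition S (suc r)
    byCases (inj₁ S≈0) = zeroDecomposition (suc r) S≈0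
    byCases (inj₂ S≉0) = fromComponent (component S S-sym S≉0)

  -- Ranks

  -- Ranks are given by their graphs, so a bound on the tensor rank requires an attained minimum,
  -- found by excluded middle.
  minimum-exists : (P : ℕ → Set (c ⊔ ℓ₁)) → ∀ t → P t → ∃[ s ] P s × s ℕ.≤ t × (∀ t′ → P t′ → s ℕ.≤ t′)
  minimum-exists P zero    P0 = 0 , P0 , ℕ.z≤n , λ _ _ → ℕ.z≤n
  minimum-exists P (suc t) Pt with decide (P 0)
  ... | yes P0 = 0 , P0 , ℕ.z≤n , λ _ _ → ℕ.z≤n
  ... | no ¬P0 with minimum-exists (P ∘ suc) t Pt
  ... | s , Ps , s≤t , least = suc s , Ps , ℕ.s≤s s≤t , λ
    { zero P0 → contradiction P0 ¬P0 ; (suc t′) Pt′ → ℕ.s≤s (least t′ Pt′) }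

  maximum-exists : (P : ℕ → Set (c ⊔ ℓ₁)) → P 0 → ∀ b → (∀ t → P t → t ℕ.≤ b) → ∃[ s ] P s × (∀ t → P t → t ℕ.≤ s)
  maximum-exists P P0 zero    bound = 0 , P0 , bound
  maximum-exists P P0 (suc b) bound with decide (P (suc b))
  ... | yes Pb = suc b , Pb , bound
  ... | no ¬Pb = maximum-exists P P0 b λ t Pt → ℕ.s≤s⁻¹ (ℕ.≤∧≢⇒< (bound t Pt) λ { ≡.refl → ¬Pb Pt })

  dependent? : ∀ {s n} (x : Fin s → Vec n) → Dependent x ⊎ LinearlyIndependent x
  dependent? x with decide (Dependent x)
  ... | yes dep = inj₁ dep
  ... | no ¬dep = inj₂ independent
    where
    independent : LinearlyIndependent x
    independent b h with zeroVec? b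
    ... | yes b≋0 = b≋0
    ... | no  b≉0 = contradiction (b , b≉0 , λ i → trans (∑≈sum _) (h i)) ¬dep

  independent⇒¬dependent : ∀ {s n} {x : Fin s → Vec n} → LinearlyIndependent x → ¬ Dependent x
  independent⇒¬dependent indep (b , b≉0 , h) = b≉0 (indep b λ i → trans (sym (∑≈sum _)) (h i))

  -- More vectors than spanning vectors: the coefficient matrix `G` has a nonzero kernel vector,
  -- which is a relation.
  spanned⇒dependent : ∀ {s t n} (e : Fin s → Vec n) (x : Fin t → Vec n) (G : Fin s → Fin t → Carrier) →
    (∀ q i → x q i ≈ ∑ (λ p → e p i * G p q)) → s ℕ.< t → Dependent x
  spanned⇒dependent e x G x≈ s<t with homogeneousSystem s<t G
  ... | b , b≉0 , Gb≋0 = b , b≉0 , λ i → begin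
    ∑ (λ q → b q * x q i)                          ≈⟨ ∑-cong (λ q → *-congˡ (x≈ q i)) ⟩
    ⟨ b , (λ q → ∑ λ p → e p i * G p q) ⟩          ≈⟨ ⟨⟩-combineʳ b (λ p → e p i) G ⟩
    ∑ (λ p → e p i * ⟨ b , G p ⟩)                  ≈⟨ ∑-≈0 (λ p → trans (*-congˡ (trans (⟨⟩-comm _ _) (Gb≋0 p))) (zeroʳ _)) ⟩
    0#                                             ∎

  -- By maximality, adjoining column `j` creates a relation; its coefficient at that column is
  -- nonzero since the chosen columns are independent, so the relation can be solved for the column.
  column-spanned : ∀ {n s} (M : Matrix n) (f : Fin s → Fin n) → LinearlyIndependent (λ p → column M (f p)) →
    (∀ t → HasIndependentColumns M t → t ℕ.≤ s) → ∀ j → Σ[ g ∈ Vec s ] (∀ i → M i j ≈ ∑ (λ p → M i (f p) * g p))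
  column-spanned {n} {s} M f indep maximal j = byCases (dependent? (λ p → column M (f′ p)))
    where
    f′ : Fin (suc s) → Fin n
    f′ zero    = j
    f′ (suc p) = f p
    fromInverse : ∀ (b : Vec (suc s)) → (∀ i → ∑ (λ p → b p * M i (f′ p)) ≈ 0#) → ∃[ z ] b zero * z ≈ 1# →
      Σ[ g ∈ Vec s ] (∀ i → M i j ≈ ∑ (λ p → M i (f p) * g p))
    fromInverse b dep (z , inv) = (λ p → - z * b (suc p)) , λ i → begin
      M i j                                                ≈⟨ *-identityˡ _ ⟨
      1# * M i j                                           ≈⟨ *-congʳ inv ⟨
      b zero * z * M i j                                   ≈⟨ rearrange (b zero) z (M i j) (σ i) ⟩
      z * (b zero * M i j + σ i) + - z * σ i               ≈⟨ +-cong (trans (*-congˡ (trans (sym (∑-suc _)) (dep i))) (zeroʳ z)) (*-∑ (- z) _) ⟩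
      0# + ∑ (λ p → - z * (b (suc p) * M i (f p)))         ≈⟨ +-identityˡ _ ⟩
      ∑ (λ p → - z * (b (suc p) * M i (f p)))              ≈⟨ ∑-cong (λ p → trans (sym (*-assoc _ _ _)) (*-comm _ _)) ⟩
      ∑ (λ p → M i (f p) * (- z * b (suc p)))              ∎
      where
      σ : Vec n
      σ i = ∑ λ p → b (suc p) * M i (f p)
      rearrange : ∀ b z m σ → b * z * m ≈ z * (b * m + σ) + - z * σ
      rearrange = solve 4 (λ b z m σ → b :* z :* m := z :* (b :* m :+ σ) :+ (:- z) :* σ) refl
    byCases : Dependent (λ p → column M (f′ p)) ⊎ LinearlyIndependent (λ p → column M (f′ p)) →
      Σ[ g ∈ Vec s ] (∀ i → M i j ≈ ∑ (λ p → M i (f p) * g p))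
    byCases (inj₂ indep′) = contradiction (maximal (suc s) (f′ , indep′)) ℕ.1+n≰n
    byCases (inj₁ (b , b≉0 , dep)) = fromInverse b dep (invertible (b zero) b₀≉0)
      where
      b₀≉0 : ¬ b zero ≈ 0#
      b₀≉0 b₀≈0 = independent⇒¬dependent indep (b ∘ suc , (λ h → b≉0 λ { zero → b₀≈0 ; (suc p) → h p }) , λ i → begin
        ∑ (λ p → b (suc p) * M i (f p))                    ≈⟨ trans (+-congʳ (trans (*-congʳ b₀≈0) (zeroˡ _))) (+-identityˡ _) ⟨
        b zero * M i j + ∑ (λ p → b (suc p) * M i (f p))   ≈⟨ trans (sym (∑-suc _)) (dep i) ⟩
        0#                                                 ∎)

  -- The passage from rank by columns to `RankBound`: the chosen columns span the whole image.
  matrixRank⇒dependent : ∀ {n s t} (M : Matrix n) → IsMatrixRank M s → (Y : Fin t → Vec n) → s ℕ.< t → Dependent (λ q → M ▹ Y q)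
  matrixRank⇒dependent {n} {s} {t} M ((f , indep) , maximal) Y s<t =
    spanned⇒dependent (λ p → column M (f p)) (λ q → M ▹ Y q) (λ p q → ⟨ (λ j → g j p) , Y q ⟩) (λ q i → begin
      ⟨ M i , Y q ⟩                                        ≈⟨ ⟨⟩-cong (λ j → proj₂ (spanned j) i) (λ _ → refl) ⟩
      ⟨ (λ j → ∑ λ p → M i (f p) * g j p) , Y q ⟩          ≈⟨ ⟨⟩-combineˡ (Y q) (λ p → M i (f p)) (λ p j → g j p) ⟩
      ∑ (λ p → M i (f p) * ⟨ (λ j → g j p) , Y q ⟩)        ∎) s<t
    where
    spanned : ∀ j → Σ[ g ∈ Vec s ] (∀ i → M i j ≈ ∑ (λ p → M i (f p) * g p))
    spanned = column-spanned M f indep maximal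
    g : Fin n → Vec s
    g j = proj₁ (spanned j)

  matrixRank-spanned : ∀ {n r} (M : Matrix n) (e : Fin r → Vec n) (G : Fin r → Vec n) →
    (∀ i j → M i j ≈ ∑ (λ p → e p i * G p j)) → ∃[ s ] IsMatrixRank M s × s ℕ.≤ r
  matrixRank-spanned {r = r} M e G M≈ = fromMaximum
    (maximum-exists (HasIndependentColumns M) ((λ ()) , λ _ _ ()) r bounded)
    where
    bounded : ∀ t → HasIndependentColumns M t → t ℕ.≤ r
    bounded t (f , indep) = ℕ.≮⇒≥ λ r<t → independent⇒¬dependent indep
      (spanned⇒dependent e (λ q → column M (f q)) (λ p q → G p (f q)) (λ q i → M≈ i (f q)) r<t)
    fromMaximum : ∃[ s ] HasIndependentColumns M s × (∀ t → HasIndependentColumns M t → t ℕ.≤ s) → ∃[ s ] IsMatrixRank M s × s ℕ.≤ r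
    fromMaximum (s , has , maximal) = s , (has , maximal) , bounded s has

  rankOnes⇒decomposition : ∀ {n s} {T : Tensor n} → IsSumOfRankOnes T s → Decomposition T s
  rankOnes⇒decomposition (X , rankOne , T≈) = decomposition
    {u = λ p → proj₁ (rankOne p)} {v = λ p → proj₁ (proj₂ (rankOne p))} {w = λ p → proj₁ (proj₂ (proj₂ (rankOne p)))}
    λ i j k → trans (T≈ i j k) (trans (sym (∑≈sum _)) (∑-cong λ p → proj₂ (proj₂ (proj₂ (proj₂ (proj₂ (proj₂ (rankOne p)))))) i j k))

  decomposition-pad : ∀ {n s r} {T : Tensor n} → s ℕ.≤ r → Decomposition T s → Decomposition T r
  decomposition-pad {s = s} {T = T} s≤r D = go (ℕ.≤⇒≤′ s≤r)
    where
    go : ∀ {r} → s ℕ.≤′ r → Decomposition T r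
    go (ℕ.≤′-reflexive ≡.refl) = D
    go (ℕ.≤′-step s≤r) = prepend 𝟎 𝟎 𝟎 (λ i j k → sym (trans (+-congʳ (zeroʳ _)) (+-identityˡ _))) (go s≤r)

  -- Terms with a zero factor are dropped, so the number of terms may decrease.
  decomposition⇒rankOnes : ∀ {n} r {T : Tensor n} → Decomposition T r → ∃[ t ] t ℕ.≤ r × IsSumOfRankOnes T t
  decomposition⇒rankOnes zero (decomposition T≈) = 0 , ℕ.z≤n , (λ ()) , (λ ()) , λ i j k → trans (T≈ i j k) (∑-zero _)
  decomposition⇒rankOnes {n} (suc r) {T} (decomposition {u} {v} {w} T≈) =
    byCases (decomposition⇒rankOnes r (decomposition λ i j k → refl)) (zeroVec? (u zero)) (zeroVec? (v zero)) (zeroVec? (w zero))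
    where
    T₀ T′ : Tensor n
    T₀ i j k = u zero i * v zero j * w zero k
    T′ i j k = ∑ λ p → u (suc p) i * v (suc p) j * w (suc p) k
    T≈T₀+T′ : ∀ i j k → T i j k ≈ T₀ i j k + T′ i j k
    T≈T₀+T′ i j k = trans (T≈ i j k) (∑-suc _)
    Goal = ∃[ t ] t ℕ.≤ suc r × IsSumOfRankOnes T t
    dropped : ∃[ t ] t ℕ.≤ r × IsSumOfRankOnes T′ t → (∀ i j k → T₀ i j k ≈ 0#) → Goal
    dropped (t , t≤r , X , rankOne , T′≈) T₀≈0 = t , ℕ.m≤n⇒m≤1+n t≤r , X , rankOne , λ i j k →
      trans (T≈T₀+T′ i j k) (trans (+-congʳ (T₀≈0 i j k)) (trans (+-identityˡ _) (T′≈ i j k)))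
    byCases : ∃[ t ] t ℕ.≤ r × IsSumOfRankOnes T′ t → Dec (u zero ≋ 𝟎) → Dec (v zero ≋ 𝟎) → Dec (w zero ≋ 𝟎) → Goal
    byCases D (yes u≋0) _ _ = dropped D λ i j k → trans (*-congʳ (trans (*-congʳ (u≋0 i)) (zeroˡ _))) (zeroˡ _)
    byCases D _ (yes v≋0) _ = dropped D λ i j k → trans (*-congʳ (trans (*-congˡ (v≋0 j)) (zeroʳ _))) (zeroˡ _)
    byCases D _ _ (yes w≋0) = dropped D λ i j k → trans (*-congˡ (w≋0 k)) (zeroʳ _)
    byCases (t , t≤r , X , rankOne , T′≈) (no u≉0) (no v≉0) (no w≉0) = suc t , ℕ.s≤s t≤r , X′ ,
      (λ { zero → u zero , v zero , w zero , u≉0 , v≉0 , w≉0 , (λ i j k → refl) ; (suc p) → rankOne p }) ,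
      λ i j k → trans (T≈T₀+T′ i j k) (+-congˡ (T′≈ i j k))
      where
      X′ : Fin (suc t) → Tensor n
      X′ zero    = T₀
      X′ (suc p) = X p

  opaque
    unfolding ∑

    -- With `∑` unfolded, the entries of slice products are definitionally inner products of fibres.
    products⇒contractions : ∀ {n} (S : Tensor n) →
      SymmetricProducts (xSlice S) × SymmetricProducts (ySlice S) × SymmetricProducts (zSlice S) → SymmetricContractions S
    products⇒contractions S (sx , sy , sz) =
      (λ i j i′ j′ → proj₁ (sx i i′) j j′) ,
      (λ i k i′ k′ → proj₂ (sx i i′) k k′) ,
      (λ k j k′ j′ → trans (proj₂ (sy j j′) k k′) (⟨⟩-comm (swapXZ S k′ j) (swapXZ S k j′)))

    contractions⇒products : ∀ {n} (S : Tensor n) → SymmetricContractions S →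
      SymmetricProducts (xSlice S) × SymmetricProducts (ySlice S) × SymmetricProducts (zSlice S)
    contractions⇒products S (sz , sy , sx) =
      (λ k l → (λ i j → sz k i l j) , (λ i j → sy k i l j)) ,
      (λ k l → (λ i j → trans (sz i k j l) (⟨⟩-comm (S i l) (S j k))) ,
               (λ i j → trans (sx i k j l) (⟨⟩-comm (swapXZ S i l) (swapXZ S j k)))) ,
      (λ k l → (λ i j → trans (sy i k j l) (⟨⟩-comm (swapYZ S i l) (swapYZ S j k))) ,
               (λ i j → sx k i l j))

  -- Extension to pairwise orthogonal families

  PairwiseOrthogonal : ∀ {r n} → (Fin r → Vec n) → Set ℓ₁
  PairwiseOrthogonal w = ∀ p q → ¬ p ≡ q → ⟨ w p , w q ⟩ ≈ 0#

  -- In the double sum over `p` and `q` only the diagonal survives orthogonality, and there `a-swap`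
  -- gives the symmetry.
  orthogonal⇒lastSymmetric : ∀ {n r} {T : Tensor n} (a : Fin r → Matrix n) (w : Fin r → Vec n) → PairwiseOrthogonal w →
    (∀ i j k → T i j k ≈ ∑ (λ p → a p i j * w p k)) →
    (∀ p i j i′ j′ → a p i j * a p i′ j′ ≈ a p i j′ * a p i′ j) → LastSymmetric T
  orthogonal⇒lastSymmetric {T = T} a w w⊥ T≈ a-swap i j i′ j′ = begin
    ⟨ T i j , T i′ j′ ⟩                                                ≈⟨ expand i j i′ j′ ⟩
    ∑ (λ p → ∑ λ q → a p i j * (a q i′ j′ * ⟨ w p , w q ⟩))            ≈⟨ ∑-cong (λ p → ∑-cong λ q → term p q) ⟩
    ∑ (λ p → ∑ λ q → a p i j′ * (a q i′ j * ⟨ w p , w q ⟩))            ≈⟨ expand i j′ i′ j ⟨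
    ⟨ T i j′ , T i′ j ⟩                                                ∎
    where
    expand : ∀ i j i′ j′ → ⟨ T i j , T i′ j′ ⟩ ≈ ∑ (λ p → ∑ λ q → a p i j * (a q i′ j′ * ⟨ w p , w q ⟩))
    expand i j i′ j′ = trans (⟨⟩-cong (T≈ i j) (T≈ i′ j′)) (trans (⟨⟩-combineˡ _ (λ p → a p i j) w)
      (∑-cong λ p → trans (*-congˡ (⟨⟩-combineʳ (w p) (λ q → a q i′ j′) w)) (*-∑ _ _)))
    term : ∀ p q → a p i j * (a q i′ j′ * ⟨ w p , w q ⟩) ≈ a p i j′ * (a q i′ j * ⟨ w p , w q ⟩)
    term p q with p ≟ q
    ... | yes ≡.refl = trans (sym (*-assoc _ _ _)) (trans (*-congʳ (a-swap p i j i′ j′)) (*-assoc _ _ _))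
    ... | no  p≢q    = trans (vanish _ _) (sym (vanish _ _))
      where
      vanish : ∀ x y → x * (y * ⟨ w p , w q ⟩) ≈ 0#
      vanish x y = trans (*-congˡ (trans (*-congˡ (w⊥ p q p≢q)) (zeroʳ y))) (zeroʳ x)

  -- One coordinate is appended per vector: 1 for the vector itself, and minus the inner product for the later ones.
  complement : ∀ {r} (G : Matrix r) → Symmetric G →
    Σ[ E ∈ (Fin r → Vec r) ] (∀ p q → ¬ p ≡ q → G p q + ⟨ E p , E q ⟩ ≈ 0#)
  complement {zero}  G G-sym = (λ ()) , λ ()
  complement {suc r} G G-sym = extend (complement G′ λ p q → +-cong (G-sym (suc p) (suc q)) (*-comm _ _))
    where
    G′ : Matrix r
    -- The new first coordinates of `E (suc p)` and `E (suc q)` contribute this product, so the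
    -- remaining coordinates must cancel the corrected matrix.
    G′ p q = G (suc p) (suc q) + G zero (suc p) * G zero (suc q)
    extend : Σ[ E ∈ (Fin r → Vec r) ] (∀ p q → ¬ p ≡ q → G′ p q + ⟨ E p , E q ⟩ ≈ 0#) →
             Σ[ E ∈ (Fin (suc r) → Vec (suc r)) ] (∀ p q → ¬ p ≡ q → G p q + ⟨ E p , E q ⟩ ≈ 0#)
    extend (E′ , E′⊥) = E , E⊥
      where
      E : Fin (suc r) → Vec (suc r)
      E zero    zero    = 1#
      E zero    (suc j) = 0#
      E (suc p) zero    = - G zero (suc p)
      E (suc p) (suc j) = E′ p j
      first : ∀ q → G zero (suc q) + ⟨ E zero , E (suc q) ⟩ ≈ 0#
      first q = begin
        g + ⟨ E zero , E (suc q) ⟩           ≈⟨ +-congˡ (⟨⟩-suc (E zero) (E (suc q))) ⟩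
        g + (1# * - g + ⟨ 𝟎 , E′ q ⟩)        ≈⟨ +-congˡ (+-cong (*-identityˡ _) (⟨⟩-zeroˡ _ (λ _ → refl))) ⟩
        g + (- g + 0#)                       ≈⟨ trans (+-congˡ (+-identityʳ _)) (-‿inverseʳ g) ⟩
        0#                                   ∎
        where g = G zero (suc q)
      E⊥ : ∀ p q → ¬ p ≡ q → G p q + ⟨ E p , E q ⟩ ≈ 0#
      E⊥ zero    zero    0≢0 = contradiction ≡.refl 0≢0
      E⊥ zero    (suc q) _   = first q
      E⊥ (suc p) zero    _   = trans (+-cong (G-sym (suc p) zero) (⟨⟩-comm _ _)) (first p)
      E⊥ (suc p) (suc q) p≢q = begin
        G (suc p) (suc q) + ⟨ E (suc p) , E (suc q) ⟩   ≈⟨ +-congˡ (⟨⟩-suc (E (suc p)) (E (suc q))) ⟩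
        G (suc p) (suc q) + (- G zero (suc p) * - G zero (suc q) + ⟨ E′ p , E′ q ⟩)
          ≈⟨ regroup _ _ _ _ ⟩
        G′ p q + ⟨ E′ p , E′ q ⟩                        ≈⟨ E′⊥ p q (p≢q ∘ ≡.cong suc) ⟩
        0#                                              ∎
        where
        regroup : ∀ g a b e → g + (- a * - b + e) ≈ g + a * b + e
        regroup = solve 4 (λ g a b e → g :+ ((:- a) :* (:- b) :+ e) := g :+ a :* b :+ e) refl

  append : ∀ {n r} → Vec n → Vec r → Vec (n ℕ.+ r)
  append {zero}  x y i       = y i
  append {suc n} x y zero    = x zero
  append {suc n} x y (suc i) = append (x ∘ suc) y i

  append-inject≤ : ∀ {n r} (x : Vec n) (y : Vec r) i .(le : n ℕ.≤ n ℕ.+ r) → append x y (inject≤ i le) ≈ x i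
  append-inject≤ {suc n} x y zero    le = refl
  append-inject≤ {suc n} x y (suc i) le = append-inject≤ (x ∘ suc) y i (ℕ.s≤s⁻¹ le)

  ⟨⟩-append : ∀ {n r} (x x′ : Vec n) (y y′ : Vec r) → ⟨ append x y , append x′ y′ ⟩ ≈ ⟨ x , x′ ⟩ + ⟨ y , y′ ⟩
  ⟨⟩-append {zero}  x x′ y y′ = sym (trans (+-congʳ (∑-zero _)) (+-identityˡ _))
  ⟨⟩-append {suc n} x x′ y y′ = begin
    ⟨ append x y , append x′ y′ ⟩                                             ≈⟨ ∑-suc _ ⟩
    x zero * x′ zero + ⟨ append (x ∘ suc) y , append (x′ ∘ suc) y′ ⟩          ≈⟨ +-congˡ (⟨⟩-append (x ∘ suc) (x′ ∘ suc) y y′) ⟩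
    x zero * x′ zero + (⟨ x ∘ suc , x′ ∘ suc ⟩ + ⟨ y , y′ ⟩)                  ≈⟨ +-assoc _ _ _ ⟨
    x zero * x′ zero + ⟨ x ∘ suc , x′ ∘ suc ⟩ + ⟨ y , y′ ⟩                    ≈⟨ +-congʳ (⟨⟩-suc x x′) ⟨
    ⟨ x , x′ ⟩ + ⟨ y , y′ ⟩                                                   ∎

  -- `complement`, applied to the Gram matrix of `x`, supplies tails whose inner products cancel
  -- those of distinct vectors.
  orthogonalExtension : ∀ {n r} (x : Fin r → Vec n) →
    Σ[ x⁺ ∈ (Fin r → Vec (n ℕ.+ r)) ] PairwiseOrthogonal x⁺ × (∀ p i .(le : n ℕ.≤ n ℕ.+ r) → x⁺ p (inject≤ i le) ≈ x p i)
  orthogonalExtension {n} {r} x = extend (complement (λ p q → ⟨ x p , x q ⟩) (λ p q → ⟨⟩-comm _ _))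
    where
    extend : Σ[ E ∈ (Fin r → Vec r) ] (∀ p q → ¬ p ≡ q → ⟨ x p , x q ⟩ + ⟨ E p , E q ⟩ ≈ 0#) →
      Σ[ x⁺ ∈ (Fin r → Vec (n ℕ.+ r)) ] PairwiseOrthogonal x⁺ × (∀ p i .(le : n ℕ.≤ n ℕ.+ r) → x⁺ p (inject≤ i le) ≈ x p i)
    extend (E , E⊥) = (λ p → append (x p) (E p)) ,
      (λ p q p≢q → trans (⟨⟩-append (x p) (x q) (E p) (E q)) (E⊥ p q p≢q)) ,
      λ p i le → append-inject≤ (x p) (E p) i le

  -- The two implications

  OrthogonalExtension : ∀ {n} → Tensor n → ℤ → Set (c ⊔ ℓ₁)
  OrthogonalExtension {n} T r = Σ[ N ∈ ℕ ] + N ≡ r ℤ.+ + n ×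
    (Σ[ S ∈ Tensor N ]
      (SymmetricProducts (xSlice S) × SymmetricProducts (ySlice S) × SymmetricProducts (zSlice S)) ×
      IsSubtensor T S ×
      (∀ (M : Matrix N) → InSpan M (zSlice S) → MatrixRank≤ M r))

  decomposition⇒extension : ∀ {n r} {T : Tensor n} → Decomposition T r → OrthogonalExtension T (+ r)
  decomposition⇒extension {n} {r} {T} (decomposition {u} {v} {w} T≈) =
    build (orthogonalExtension u) (orthogonalExtension v) (orthogonalExtension w)
    where
    Ext : (Fin r → Vec n) → Set (c ⊔ ℓ₁)
    Ext x = Σ[ x⁺ ∈ (Fin r → Vec (n ℕ.+ r)) ] PairwiseOrthogonal x⁺ × (∀ p i .(le : n ℕ.≤ n ℕ.+ r) → x⁺ p (inject≤ i le) ≈ x p i)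
    build : Ext u → Ext v → Ext w → OrthogonalExtension T (+ r)
    build (u⁺ , u⁺⊥ , u⁺≈) (v⁺ , v⁺⊥ , v⁺≈) (w⁺ , w⁺⊥ , w⁺≈) =
      -- The original coordinates come first, where `inject≤` looks for them; hence the size is
      -- `n ℕ.+ r`, commuted to match the statement.
      n ℕ.+ r , ≡.cong +_ (ℕ.+-comm n r) , S , contractions⇒products S (sz , sy , sx) ,
      (ℕ.m≤m+n n r , λ i j k → trans (T≈ i j k) (∑-cong λ p → sym (*-cong (*-cong (u⁺≈ p i le) (v⁺≈ p j le)) (w⁺≈ p k le)))) ,
      rank
      where
      le = ℕ.m≤m+n n r
      S : Tensor (n ℕ.+ r)
      S i j k = ∑ λ p → u⁺ p i * v⁺ p j * w⁺ p k
      swap : ∀ a b c d → a * b * (c * d) ≈ a * d * (c * b)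
      swap = solve 4 (λ a b c d → a :* b :* (c :* d) := a :* d :* (c :* b)) refl
      sz : LastSymmetric S
      sz = orthogonal⇒lastSymmetric (λ p i j → u⁺ p i * v⁺ p j) w⁺ w⁺⊥ (λ _ _ _ → refl) (λ p i j i′ j′ → swap _ _ _ _)
      sy : LastSymmetric (swapYZ S)
      sy = orthogonal⇒lastSymmetric (λ p i k → u⁺ p i * w⁺ p k) v⁺ v⁺⊥
        (λ i k j → ∑-cong λ p → trans (*-assoc _ _ _) (trans (*-congˡ (*-comm _ _)) (sym (*-assoc _ _ _)))) (λ p i j i′ j′ → swap _ _ _ _)
      sx : LastSymmetric (swapXZ S)
      sx = orthogonal⇒lastSymmetric (λ p k j → w⁺ p k * v⁺ p j) u⁺ u⁺⊥
        (λ k j i → ∑-cong λ p → trans (*-comm _ _) (trans (*-congˡ (*-comm _ _)) (sym (*-assoc _ _ _)))) (λ p i j i′ j′ → swap _ _ _ _)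
      rank : ∀ M → InSpan M (zSlice S) → MatrixRank≤ M (+ r)
      -- Every column of `M` is a combination of the `r` vectors `u⁺ p`.
      rank M (a , M≈) = toℤ (matrixRank-spanned M u⁺ (λ p j → ⟨ a , w⁺ p ⟩ * v⁺ p j) λ i j → begin
        M i j                                             ≈⟨ trans (M≈ i j) (sym (∑≈sum _)) ⟩
        ⟨ a , S i j ⟩                                     ≈⟨ ⟨⟩-combineʳ a (λ p → u⁺ p i * v⁺ p j) w⁺ ⟩
        ∑ (λ p → u⁺ p i * v⁺ p j * ⟨ a , w⁺ p ⟩)          ≈⟨ ∑-cong (λ p → trans (*-assoc _ _ _) (*-congˡ (*-comm _ _))) ⟩
        ∑ (λ p → u⁺ p i * (⟨ a , w⁺ p ⟩ * v⁺ p j))        ∎)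
        where
        toℤ : ∃[ s ] IsMatrixRank M s × s ℕ.≤ r → MatrixRank≤ M (+ r)
        toℤ (s , isRank , s≤r) = s , isRank , ℤ.+≤+ s≤r

  tensorRank≤⇒extension : ∀ {n} (T : Tensor n) r → TensorRank≤ T r → OrthogonalExtension T r
  tensorRank≤⇒extension T (+ r) (s , (sumOfRankOnes , _) , ℤ.+≤+ s≤r) =
    decomposition⇒extension (decomposition-pad s≤r (rankOnes⇒decomposition sumOfRankOnes))
  tensorRank≤⇒extension T -[1+ r ] (s , _ , ())

  extension⇒tensorRank≤ : ∀ {n} (T : Tensor n) r → OrthogonalExtension T r → TensorRank≤ T r
  -- For negative `r` the zero matrix, which lies in every span, would have a negative rank.
  extension⇒tensorRank≤ T -[1+ r ] (N , _ , S , _ , _ , ranks) = impossible (ranks (λ _ _ → 0#) ((λ _ → 0#) , λ i j →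
    sym (trans (sym (∑≈sum (λ k → 0# * S i j k))) (∑-≈0 λ k → zeroˡ _))))
    where
    impossible : MatrixRank≤ (λ (i j : Fin N) → 0#) -[1+ r ] → TensorRank≤ T -[1+ r ]
    impossible (s , _ , ())
  extension⇒tensorRank≤ {n} T (+ r) (N , _ , S , products , (n≤N , T≈S) , ranks) =
    toRank (decomposition⇒rankOnes r (restrict (decompose r S (products⇒contractions S products) S-bound)))
    where
    S-bound : RankBound r S
    S-bound a Y = fromRank (ranks (contraction S a) (a , λ i j → trans (⟨⟩-comm _ _) (∑≈sum _)))
      where
      fromRank : MatrixRank≤ (contraction S a) (+ r) → Dependent (λ p → contraction S a ▹ Y p)
      fromRank (s , isRank , ℤ.+≤+ s≤r) = matrixRank⇒dependent (contraction S a) isRank Y (ℕ.s≤s s≤r)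
    restrict : Decomposition S r → Decomposition T r
    restrict (decomposition {u} {v} {w} S≈) = decomposition
      {u = λ p i → u p (inject≤ i n≤N)} {v = λ p j → v p (inject≤ j n≤N)} {w = λ p k → w p (inject≤ k n≤N)}
      λ i j k → trans (T≈S i j k) (S≈ _ _ _)
    toRank : ∃[ t ] t ℕ.≤ r × IsSumOfRankOnes T t → TensorRank≤ T (+ r)
    toRank (t , t≤r , sumOfRankOnes) with minimum-exists (IsSumOfRankOnes T) t sumOfRankOnes
    ... | s , isSum , s≤t , least = s , (isSum , least) , ℤ.+≤+ (ℕ.≤-trans s≤t t≤r)

  tensorRank≤⇔extension : ∀ {n} (T : Tensor n) r → TensorRank≤ T r ⇔ OrthogonalExtension T r
  tensorRank≤⇔extension T r = mk⇔ (tensorRank≤⇒extension T r) (extension⇒tensorRank≤ T r)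

open import Data.Integer.Base using (_+_)

theorem23 : ∀ {c ℓ₁ ℓ₂} → ExcludedMiddle (c ⊔ ℓ₁ ⊔ ℓ₂) →
    (ℝ : CompleteOrderedField c ℓ₁ ℓ₂) → let open RealTensors ℝ in
    (n : ℕ) (T : Tensor n) (r : ℤ) →
    TensorRank≤ T r ⇔
    (Σ[ N ∈ ℕ ] + N ≡ r + + n ×
    (Σ[ S ∈ Tensor N ]
    (SymmetricProducts (xSlice S) × SymmetricProducts (ySlice S) × SymmetricProducts (zSlice S)) ×
    IsSubtensor T S ×
    (∀ (M : Matrix N) → InSpan M (zSlice S) → MatrixRank≤ M r)))
theorem23 em ℝ n T r = CompleteOrderedFieldTensors.tensorRank≤⇔extension em ℝ T r
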